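{- For every $\delta>0$ there exist a function $\varepsilon_\delta$ on prime powers with $\varepsilon_\delta(q)\to 0$ as $q\to\infty$, and $q_0(\delta)$, such that for every prime power $q\ge q_0(\delta)$ and every integer $k=q^t$ with $\frac{2}{3}+2\delta<t\le 1$, \[ |\mathcal A(q,k)| \leq \binom{(1+\varepsilon_\delta(q))q}{k}. \]
   Context: $\mathbb F_q$ denotes the finite field with $q$ elements. An arc in $\mathbb F_q^2$ is a set $P\subseteq \mathbb F_q^2$ such that no three distinct points of $P$ lie on a common line. $\mathcal A(q,k)$ denotes the family of all arcs in $\mathbb F_q^2$ of cardinality exactly $k$. For real $x\ge k$, $\binom{x}{k}=\frac{x(x-1)\cdots(x-k+1)}{k!}$. -}

module Defs where

open import Data.Nat as ℕ using (ℕ; zero; suc; _!)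
open import Data.Nat.Properties using (_!≢0)
open import Data.Nat.Primality using (Prime)
open import Data.Integer using (+_)
open import Data.Rational using (ℚ; 1ℚ; _/_; _*_; _-_)
open import Data.Fin using (Fin)
open import Data.Fin.Subset using (Subset; inside; ∣_∣)
open import Data.Vec using (Vec; lookup; sum; map)
open import Data.Product using (_×_; _,_; ∃; Σ)
open import Relation.Nullary using (¬_)
open import Relation.Binary.PropositionalEquality using (_≡_)
open import Algebra.Structures using (IsCommutativeRing)

IsPrimePower : ℕ → Set
IsPrimePower q = Σ ℕ λ p → Σ ℕ λ e → Prime p × q ≡ p ℕ.^ suc e

record FiniteField (q : ℕ) : Set where
  field
    _+F_ _*F_ : Fin q → Fin q → Fin q
    -F_ : Fin q → Fin q
    0F 1F : Fin q
    isCommutativeRing : IsCommutativeRing _≡_ _+F_ _*F_ -F_ 0F 1F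
    0≢1 : ¬ (0F ≡ 1F)
    inverse : ∀ x → ¬ (x ≡ 0F) → ∃ λ y → x *F y ≡ 1F

module _ {q : ℕ} (F : FiniteField q) where
  open FiniteField F

  Point : Set
  Point = Fin q × Fin q

  record Line : Set where
    field
      a b c : Fin q
      nondeg : ¬ (a ≡ 0F × b ≡ 0F)

  OnLine : Line → Point → Set
  OnLine L (x , y) = (Line.a L *F x) +F (Line.b L *F y) ≡ Line.c L

-- a set of points of F_q^2, as a q × q table of membership bits
PointSet : ℕ → Set
PointSet q = Vec (Subset q) q

_∈P_ : {q : ℕ} → Fin q × Fin q → PointSet q → Set
(x , y) ∈P P = lookup (lookup P x) y ≡ inside

size : {q : ℕ} → PointSet q → ℕ
size P = sum (map ∣_∣ P)

IsArc : {q : ℕ} → FiniteField q → PointSet q → Set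
IsArc F P = ∀ p₁ p₂ p₃ → p₁ ∈P P → p₂ ∈P P → p₃ ∈P P →
  ¬ (p₁ ≡ p₂) → ¬ (p₁ ≡ p₃) → ¬ (p₂ ≡ p₃) →
  ¬ (∃ λ (L : Line F) → OnLine F L p₁ × OnLine F L p₂ × OnLine F L p₃)

IsArcOfSize : {q : ℕ} → FiniteField q → ℕ → PointSet q → Set
IsArcOfSize F k P = IsArc F P × size P ≡ k

toℚ : ℕ → ℚ
toℚ n = (+ n) / 1

fallingℚ : ℚ → ℕ → ℚ
fallingℚ x zero = 1ℚ
fallingℚ x (suc k) = fallingℚ x k * (x - toℚ k)

binomℚ : ℚ → ℕ → ℚ
binomℚ x k = fallingℚ x k * ((+ 1) / (k !)) {{k !≢0}}

{-# OPTIONS --safe #-}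
module Submission where

-- A Kleitman–Winston container argument. Choose s points S of an arc A. Join two
-- further points u, v of the plane when the line uv meets S; then A ∖ S is an
-- independent set of this graph. Inside any set C of points, each s ∈ S sees C in
-- q + 1 directions, so by Cauchy–Schwarz at least |C|²/(q+1) ordered pairs (u, v)
-- of C lie in a common direction from s; as S is itself an arc, a pair u ≠ v is
-- counted for at most two s ∈ S. Hence as soon as |C| ≥ (1 + 1/m)(q + 1), some
-- vertex v of C is joined to a proportion at least about s/(2mq) of C. Branching on
-- whether v ∈ A, every positive answer shrinks C by this proportion, so after
-- T = O((mq/s) log q) positive answers |C| ≤ (1 + O(1/m)) q =: M. This gives
--   |𝒜(q,k)| ≤ Q^(s+T) · binom(M, k)   for any Q > q²k.
-- With m ≈ q^(1/27), so that q < 2^(27m) and Q = 2^(81m) is admissible, and with s and T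
-- of order k/m³ (possible since k³ > q²), the factor Q^(s+T) is at most (1 + 1/m)^k and is absorbed by enlarging M to
-- (1 + 1/m) M ≤ (1 + O(1/m)) q.

open import Defs
open import Data.Nat
open import Data.Nat.Properties
open import Data.Nat.Combinatorics using (nCk+nC[k+1]≡[n+1]C[k+1]; nC1≡n; k>n⇒nCk≡0) renaming (_C_ to _choose_)
open import Data.Nat.Combinatorics.Base using (_P′_)
open import Data.Nat.DivMod using (m≡m%n+[m/n]*n; m%n<n; m/n*n≤m; m/n≤m)
open import Data.Nat.Tactic.RingSolver using (solve-∀)
import Data.Integer as ℤ
import Data.Integer.Properties as ℤ
open import Data.Rational as ℚ using (ℚ; 0ℚ; 1ℚ; mkℚ; toℚᵘ)
import Data.Rational.Properties as ℚ
open import Data.Rational.Unnormalised as ℚᵘ using (mkℚᵘ; *≡*; *≤*; *<*)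
import Data.Rational.Unnormalised.Properties as ℚᵘ
open import Data.Bool using (Bool; true; false)
import Data.Bool.Properties as Bool
open import Data.Fin using (Fin; zero; suc)
import Data.Fin.Properties as Fin
open import Data.Fin.Subset using (Subset; ∣_∣)
open import Data.List as List using (List; []; _∷_; _++_; length; filter; tabulate; allFin; cartesianProduct)
open import Data.List.Properties using (length-tabulate; length-filter; filter-accept; filter-reject)
open import Data.List.Membership.Propositional using (_∈_; _∉_)
open import Data.List.Membership.Propositional.Properties using (∈-filter⁺; ∈-filter⁻; ∈-allFin; ∈-cartesianProduct⁺)
open import Data.List.Relation.Unary.All as All using (All; []; _∷_)
open import Data.List.Relation.Unary.Any using (here; there)
open import Data.List.Relation.Unary.AllPairs using ([]; _∷_)
open import Data.List.Relation.Unary.Unique.Propositional using (Unique)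
open import Data.List.Relation.Unary.Unique.Propositional.Properties using (allFin⁺; filter⁺; cartesianProduct⁺)
open import Data.Vec as Vec using (Vec; []; _∷_; lookup)
open import Data.Product using (_×_; _,_; Σ; ∃; proj₁; proj₂)
open import Data.Product.Properties using (≡-dec)
open import Algebra.Bundles using (CommutativeRing)
import Algebra.Properties.Group
import Algebra.Properties.Ring
open import Function using (_∘_; id)
open import Relation.Binary.Definitions using (DecidableEquality)
open import Relation.Binary.PropositionalEquality
open import Relation.Nullary using (¬_; Dec; does; yes; no; contradiction; ¬?)
open import Relation.Unary using (Decidable)

private
  variable
    A B : Set


-- Finite sums

∑ : List A → (A → ℕ) → ℕ
∑ []       f = 0
∑ (x ∷ xs) f = f x + ∑ xs f

∑-cong : (xs : List A) {f g : A → ℕ} → (∀ x → f x ≡ g x) → ∑ xs f ≡ ∑ xs g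
∑-cong []       f≗g = refl
∑-cong (x ∷ xs) f≗g = cong₂ _+_ (f≗g x) (∑-cong xs f≗g)

∑-mono : (xs : List A) {f g : A → ℕ} → (∀ {x} → x ∈ xs → f x ≤ g x) → ∑ xs f ≤ ∑ xs g
∑-mono []       f≤g = z≤n
∑-mono (x ∷ xs) f≤g = +-mono-≤ (f≤g (here refl)) (∑-mono xs (f≤g ∘ there))

∑-+ : (xs : List A) (f g : A → ℕ) → ∑ xs (λ x → f x + g x) ≡ ∑ xs f + ∑ xs g
∑-+ []       f g = refl
∑-+ (x ∷ xs) f g = trans (cong (f x + g x +_) (∑-+ xs f g)) (shuffle (f x) (g x) _ _)
  where
  shuffle : ∀ a b c d → a + b + (c + d) ≡ a + c + (b + d)
  shuffle = solve-∀

∑-*ˡ : (xs : List A) (c : ℕ) (f : A → ℕ) → ∑ xs (λ x → c * f x) ≡ c * ∑ xs f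
∑-*ˡ []       c f = sym (*-zeroʳ c)
∑-*ˡ (x ∷ xs) c f = trans (cong (c * f x +_) (∑-*ˡ xs c f)) (sym (*-distribˡ-+ c (f x) _))

∑-const : (xs : List A) (c : ℕ) → ∑ xs (λ _ → c) ≡ length xs * c
∑-const []       c = refl
∑-const (x ∷ xs) c = cong (c +_) (∑-const xs c)

∑-swap : (xs : List A) (ys : List B) (f : A → B → ℕ) →
         ∑ xs (λ x → ∑ ys (f x)) ≡ ∑ ys (λ y → ∑ xs (λ x → f x y))
∑-swap []       ys f = sym (trans (∑-const ys 0) (*-zeroʳ (length ys)))
∑-swap (x ∷ xs) ys f = trans (cong (∑ ys (f x) +_) (∑-swap xs ys f)) (sym (∑-+ ys (f x) _))

∑-pigeonhole : (xs : List A) (f : A → ℕ) (K : ℕ) → 0 < length xs →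
               length xs * K ≤ ∑ xs f → ∃ λ x → x ∈ xs × K ≤ f x
∑-pigeonhole (x ∷ xs) f K _ le with K ≤? f x
... | yes K≤fx = x , here refl , K≤fx
∑-pigeonhole (x ∷ []) f K _ le | no K≰fx =
  contradiction (subst₂ _≤_ (+-identityʳ K) (+-identityʳ (f x)) le) K≰fx
∑-pigeonhole (x ∷ xs@(_ ∷ _)) f K _ le | no K≰fx
  with y , y∈xs , K≤fy ← ∑-pigeonhole xs f K (s≤s z≤n)
         (+-cancelˡ-≤ K _ _ (≤-trans le (+-monoˡ-≤ (∑ xs f) (<⇒≤ (≰⇒> K≰fx)))))
  = y , there y∈xs , K≤fy

χ : Bool → ℕ
χ true  = 1
χ false = 0

χ-yes : {P : Set} (P? : Dec P) → P → χ (does P?) ≡ 1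
χ-yes (yes _) p = refl
χ-yes (no ¬p) p = contradiction p ¬p

χ-no : {P : Set} (P? : Dec P) → ¬ P → χ (does P?) ≡ 0
χ-no (yes p) ¬p = contradiction p ¬p
χ-no (no _)  ¬p = refl

length-filter≡∑ : {P : A → Set} (P? : Decidable P) (xs : List A) →
                  length (filter P? xs) ≡ ∑ xs (λ x → χ (does (P? x)))
length-filter≡∑ P? []       = refl
length-filter≡∑ P? (x ∷ xs) with does (P? x)
... | true  = cong suc (length-filter≡∑ P? xs)
... | false = length-filter≡∑ P? xs

-- Induction on the list: squaring `f x + ∑ xs f` leaves the cross term `2 * f x * ∑ xs f`, which
-- AM-GM bounds summand by summand.
cauchy-schwarz : (xs : List A) (f : A → ℕ) →
                 ∑ xs f * ∑ xs f ≤ length xs * ∑ xs (λ x → f x * f x)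
cauchy-schwarz []       f = z≤n
cauchy-schwarz (x ∷ xs) f = begin
  (f x + ∑ xs f) * (f x + ∑ xs f)
    ≡⟨ expand (f x) (∑ xs f) ⟩
  f x * f x + 2 * f x * ∑ xs f + ∑ xs f * ∑ xs f
    ≤⟨ +-mono-≤ (+-monoʳ-≤ (f x * f x) cross) (cauchy-schwarz xs f) ⟩
  f x * f x + (length xs * (f x * f x) + q) + length xs * q
    ≡⟨ collect (f x * f x) (length xs) q ⟩
  (1 + length xs) * (f x * f x + q) ∎
  where
  open ≤-Reasoning
  q = ∑ xs (λ y → f y * f y)
  expand : ∀ a b → (a + b) * (a + b) ≡ a * a + 2 * a * b + b * b
  expand = solve-∀
  collect : ∀ a n b → a + (n * a + b) + n * b ≡ (1 + n) * (a + b)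
  collect = solve-∀
  am-gm : ∀ a b → 2 * a * b ≤ a * a + b * b
  am-gm zero    b       = z≤n
  am-gm (suc a) zero    = ≤-trans (≤-reflexive (*-zeroʳ (2 * suc a))) z≤n
  am-gm (suc a) (suc b) = begin
    2 * suc a * suc b                  ≡⟨ lhs a b ⟩
    2 * a * b + (2 * a + 2 * b + 2)    ≤⟨ +-monoˡ-≤ _ (am-gm a b) ⟩
    a * a + b * b + (2 * a + 2 * b + 2) ≡⟨ rhs a b ⟩
    suc a * suc a + suc b * suc b      ∎
    where
    lhs : ∀ a b → 2 * suc a * suc b ≡ 2 * a * b + (2 * a + 2 * b + 2)
    lhs = solve-∀
    rhs : ∀ a b → a * a + b * b + (2 * a + 2 * b + 2) ≡ suc a * suc a + suc b * suc b
    rhs = solve-∀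
  cross : 2 * f x * ∑ xs f ≤ length xs * (f x * f x) + q
  cross = begin
    2 * f x * ∑ xs f                       ≡⟨ ∑-*ˡ xs (2 * f x) f ⟨
    ∑ xs (λ y → 2 * f x * f y)             ≤⟨ ∑-mono xs (λ {y} _ → am-gm (f x) (f y)) ⟩
    ∑ xs (λ y → f x * f x + f y * f y)     ≡⟨ ∑-+ xs _ _ ⟩
    ∑ xs (λ _ → f x * f x) + q             ≡⟨ cong (_+ q) (∑-const xs _) ⟩
    length xs * (f x * f x) + q            ∎

module _ (_≟_ : DecidableEquality A) where

  infixl 6 _∖_
  _∖_ : List A → A → List A
  xs ∖ v = filter (λ u → ¬? (u ≟ v)) xs

  ∖-∉ : ∀ v xs → All (v ≢_) xs → xs ∖ v ≡ xs
  ∖-∉ v []       []         = refl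
  ∖-∉ v (x ∷ xs) (v≢x ∷ p) with x ≟ v
  ... | yes x≡v = contradiction (sym x≡v) v≢x
  ... | no  _   = cong (x ∷_) (∖-∉ v xs p)

  ∑-∖ : ∀ {v xs} → Unique xs → v ∈ xs → (f : A → ℕ) → ∑ xs f ≡ f v + ∑ (xs ∖ v) f
  ∑-∖ {v} {x ∷ xs} (x∉ ∷ u) (here refl) f with x ≟ x
  ... | yes _  = cong (λ ys → f x + ∑ ys f) (sym (∖-∉ x xs x∉))
  ... | no x≢x = contradiction refl x≢x
  ∑-∖ {v} {x ∷ xs} (x∉ ∷ u) (there v∈xs) f with x ≟ v
  ... | yes refl = contradiction refl (All.lookup x∉ v∈xs)
  ... | no _     = trans (cong (f x +_) (∑-∖ u v∈xs f)) (swap (f x) (f v) _)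
    where
    swap : ∀ a b c → a + (b + c) ≡ b + (a + c)
    swap = solve-∀

  ∈-∖⁻ : ∀ {v u} xs → u ∈ xs ∖ v → u ∈ xs × u ≢ v
  ∈-∖⁻ xs = ∈-filter⁻ (λ u → ¬? (u ≟ _)) {xs = xs}

  ∈-∖⁺ : ∀ {v u} {xs} → u ∈ xs → u ≢ v → u ∈ xs ∖ v
  ∈-∖⁺ = ∈-filter⁺ (λ u → ¬? (u ≟ _))

  length-∖ : ∀ {v xs} → Unique xs → v ∈ xs → length xs ≡ 1 + length (xs ∖ v)
  length-∖ {v} {xs} u v∈ = begin-equality
    length xs              ≡⟨ *-identityʳ _ ⟨
    length xs * 1          ≡⟨ ∑-const xs 1 ⟨
    ∑ xs (λ _ → 1)         ≡⟨ ∑-∖ u v∈ _ ⟩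
    1 + ∑ (xs ∖ v) (λ _ → 1) ≡⟨ cong suc (trans (∑-const (xs ∖ v) 1) (*-identityʳ _)) ⟩
    1 + length (xs ∖ v) ∎
    where open ≤-Reasoning

∑-δ : ∀ {r} (i : Fin r) (a : Fin r → ℕ) → ∑ (allFin r) (λ l → χ (does (l Fin.≟ i)) * a l) ≡ a i
∑-δ {r} i a = begin-equality
  ∑ (allFin r) g                                   ≡⟨ ∑-∖ Fin._≟_ (allFin⁺ r) (∈-allFin i) g ⟩
  g i + ∑ rest g                                   ≡⟨ cong (λ z → z * a i + ∑ rest g) (χ-yes (i Fin.≟ i) refl) ⟩
  1 * a i + ∑ rest g                               ≡⟨ cong₂ _+_ (*-identityˡ (a i)) rest≡0 ⟩
  a i + 0                                          ≡⟨ +-identityʳ (a i) ⟩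
  a i                                              ∎
  where
  open ≤-Reasoning
  g : Fin r → ℕ
  g l = χ (does (l Fin.≟ i)) * a l
  rest : List (Fin r)
  rest = _∖_ Fin._≟_ (allFin r) i
  rest≡0 : ∑ rest g ≡ 0
  rest≡0 = n≤0⇒n≡0 (begin
    ∑ rest g          ≤⟨ ∑-mono rest (λ {l} l∈ → ≤-reflexive (cong (_* a l) (χ-no (l Fin.≟ i) (proj₂ (∈-∖⁻ Fin._≟_ (allFin r) l∈))))) ⟩
    ∑ rest (λ _ → 0)  ≡⟨ trans (∑-const rest 0) (*-zeroʳ (length rest)) ⟩
    0                 ∎)

-- The colour class sizes `a l` sum to `length xs`, and their squares sum to the number of ordered
-- monochromatic pairs, diagonal included; Cauchy-Schwarz over the `r` colours compares the two.
monochromatic-pairs : ∀ {r} (g : A → Fin r) (xs : List A) →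
  length xs * length xs ≤ r * ∑ xs (λ v → ∑ xs (λ u → χ (does (g v Fin.≟ g u))))
monochromatic-pairs {A = A} {r = r} g xs = begin
  length xs * length xs                                   ≡⟨ cong (λ z → z * z) total ⟨
  ∑ (allFin r) a * ∑ (allFin r) a                         ≤⟨ cauchy-schwarz (allFin r) a ⟩
  length (allFin r) * ∑ (allFin r) (λ l → a l * a l)      ≡⟨ cong₂ _*_ (length-tabulate {n = r} id) squares ⟩
  r * ∑ xs (λ v → a (g v))                                ∎
  where
  open ≤-Reasoning
  δ : Fin r → A → ℕ
  δ l u = χ (does (l Fin.≟ g u))
  a : Fin r → ℕ
  a l = ∑ xs (δ l)
  total : ∑ (allFin r) a ≡ length xs
  total = begin-equality
    ∑ (allFin r) a                                  ≡⟨ ∑-swap (allFin r) xs δ ⟩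
    ∑ xs (λ u → ∑ (allFin r) (λ l → δ l u))         ≡⟨ ∑-cong xs (λ u → ∑-cong (allFin r) (λ l → sym (*-identityʳ (δ l u)))) ⟩
    ∑ xs (λ u → ∑ (allFin r) (λ l → δ l u * 1))     ≡⟨ ∑-cong xs (λ u → ∑-δ (g u) (λ _ → 1)) ⟩
    ∑ xs (λ _ → 1)                                  ≡⟨ trans (∑-const xs 1) (*-identityʳ _) ⟩
    length xs                                       ∎
  squares : ∑ (allFin r) (λ l → a l * a l) ≡ ∑ xs (λ v → a (g v))
  squares = begin-equality
    ∑ (allFin r) (λ l → a l * a l)                  ≡⟨ ∑-cong (allFin r) (λ l → sym (∑-*ˡ xs (a l) (δ l))) ⟩
    ∑ (allFin r) (λ l → ∑ xs (λ v → a l * δ l v))   ≡⟨ ∑-swap (allFin r) xs _ ⟩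
    ∑ xs (λ v → ∑ (allFin r) (λ l → a l * δ l v))   ≡⟨ ∑-cong xs (λ v → ∑-cong (allFin r) (λ l → *-comm (a l) (δ l v))) ⟩
    ∑ xs (λ v → ∑ (allFin r) (λ l → δ l v * a l))   ≡⟨ ∑-cong xs (λ v → ∑-δ (g v) a) ⟩
    ∑ xs (λ v → a (g v))                            ∎

-- Binomial coefficients

-- Induction by Pascal's rule. Truncated subtraction is harmless: for `n ≤ k` both sides vanish.
choose-absorb : ∀ n k → (n choose suc k) * suc k ≡ (n choose k) * (n ∸ k)
choose-absorb zero    k = trans (cong (_* suc k) (k>n⇒nCk≡0 {0} {suc k} z<s))
                                (sym (trans (cong ((0 choose k) *_) (0∸n≡0 k)) (*-zeroʳ (0 choose k))))
choose-absorb (suc n) zero = trans (*-identityʳ _) (trans (nC1≡n (suc n)) (sym (*-identityˡ (suc n))))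
choose-absorb (suc n) (suc k) = begin-equality
  (suc n choose suc (suc k)) * suc (suc k)
    ≡⟨ cong (_* suc (suc k)) (nCk+nC[k+1]≡[n+1]C[k+1] n (suc k)) ⟨
  (a + (n choose suc (suc k))) * suc (suc k)
    ≡⟨ *-distribʳ-+ (suc (suc k)) a _ ⟩
  a * suc (suc k) + (n choose suc (suc k)) * suc (suc k)
    ≡⟨ cong (a * suc (suc k) +_) (choose-absorb n (suc k)) ⟩
  a * suc (suc k) + a * (n ∸ suc k)
    ≡⟨ shift (k <? n) ⟩
  a * suc k + a * (n ∸ k)
    ≡⟨ cong (_+ a * (n ∸ k)) (choose-absorb n k) ⟩
  (n choose k) * (n ∸ k) + a * (n ∸ k)
    ≡⟨ *-distribʳ-+ (n ∸ k) (n choose k) a ⟨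
  ((n choose k) + a) * (n ∸ k)
    ≡⟨ cong (_* (n ∸ k)) (nCk+nC[k+1]≡[n+1]C[k+1] n k) ⟩
  (suc n choose suc k) * (n ∸ k) ∎
  where
  open ≤-Reasoning
  a = n choose suc k
  regroup : ∀ a k d → a * suc (suc k) + a * d ≡ a * suc k + a * (1 + d)
  regroup = solve-∀
  shift : Dec (k < n) → a * suc (suc k) + a * (n ∸ suc k) ≡ a * suc k + a * (n ∸ k)
  shift (yes k<n) = trans (regroup a k (n ∸ suc k)) (cong (λ d → a * suc k + a * d) (sym (+-∸-assoc 1 k<n)))
  shift (no k≮n) rewrite k>n⇒nCk≡0 {n} {suc k} (s≤s (≮⇒≥ k≮n)) = refl

choose*! : ∀ n k → (n choose k) * k ! ≡ n P′ k
choose*! n zero    = refl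
choose*! n (suc k) = begin-equality
  (n choose suc k) * (suc k * k !)  ≡⟨ *-assoc (n choose suc k) (suc k) (k !) ⟨
  (n choose suc k) * suc k * k !    ≡⟨ cong (_* k !) (choose-absorb n k) ⟩
  (n choose k) * (n ∸ k) * k !      ≡⟨ swap (n choose k) (n ∸ k) (k !) ⟩
  (n ∸ k) * ((n choose k) * k !)    ≡⟨ cong ((n ∸ k) *_) (choose*! n k) ⟩
  (n ∸ k) * (n P′ k)                ∎
  where
  open ≤-Reasoning
  swap : ∀ a b c → a * b * c ≡ b * (a * c)
  swap = solve-∀

choose-monoˡ : ∀ {m n} k → m ≤ n → m choose k ≤ n choose k
choose-monoˡ zero    _         = ≤-refl
choose-monoˡ (suc k) z≤n = ≤-trans (≤-reflexive (k>n⇒nCk≡0 {0} {suc k} z<s)) z≤n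
choose-monoˡ {suc m} {suc n} (suc k) (s≤s m≤n) = begin
  suc m choose suc k                 ≡⟨ nCk+nC[k+1]≡[n+1]C[k+1] m k ⟨
  (m choose k) + (m choose suc k)    ≤⟨ +-mono-≤ (choose-monoˡ k m≤n) (choose-monoˡ (suc k) m≤n) ⟩
  (n choose k) + (n choose suc k)    ≡⟨ nCk+nC[k+1]≡[n+1]C[k+1] n k ⟩
  suc n choose suc k                 ∎
  where open ≤-Reasoning

-- Serves to return from `j` to `j + 1` elements after a vertex has been chosen. The lost factor is
-- crude, but it is later absorbed by `Q`.
choose-pred≤ : ∀ {n} k → k < n → n choose k ≤ suc k * (n choose suc k)
choose-pred≤ {n} k k<n = begin
  n choose k                    ≡⟨ *-identityʳ _ ⟨
  (n choose k) * 1              ≤⟨ *-monoʳ-≤ (n choose k) (m<n⇒0<n∸m k<n) ⟩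
  (n choose k) * (n ∸ k)        ≡⟨ choose-absorb n k ⟨
  (n choose suc k) * suc k      ≡⟨ *-comm (n choose suc k) (suc k) ⟩
  suc k * (n choose suc k)      ∎
  where open ≤-Reasoning

-- Counting in filtered lists

filter-split : (p : A → Bool) (xs : List A) →
  length xs ≡ length (filter (λ x → p x Bool.≟ true) xs) + length (filter (λ x → p x Bool.≟ false) xs)
filter-split p []       = refl
filter-split p (x ∷ xs) with p x
... | true  = cong suc (filter-split p xs)
... | false = trans (cong suc (filter-split p xs)) (sym (+-suc _ _))

-- Entrywise: `f x`, increased by 2 when it vanishes, is at most 2.
∑-filter-zeros : (f : A → ℕ) (xs : List A) → (∀ {x} → x ∈ xs → f x ≤ 2) →
  ∑ xs f + 2 * length (filter (λ x → f x ≟ 0) xs) ≤ 2 * length xs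
∑-filter-zeros f []       f≤2 = z≤n
∑-filter-zeros f (x ∷ xs) f≤2 = step (zero? x)
  where
  open ≤-Reasoning
  zero? = λ y → f y ≟ 0
  z = length (filter zero? xs)
  ih = ∑-filter-zeros f xs (f≤2 ∘ there)
  shift : ∀ a b → a + 2 * suc b ≡ 2 + (a + 2 * b)
  shift = solve-∀
  step : Dec (f x ≡ 0) → ∑ (x ∷ xs) f + 2 * length (filter zero? (x ∷ xs)) ≤ 2 * length (x ∷ xs)
  step (yes fx≡0) = begin
    f x + ∑ xs f + 2 * length (filter zero? (x ∷ xs))
      ≡⟨ cong₂ (λ y l → y + ∑ xs f + 2 * length l) fx≡0 (filter-accept zero? fx≡0) ⟩
    ∑ xs f + 2 * suc z    ≡⟨ shift (∑ xs f) z ⟩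
    2 + (∑ xs f + 2 * z)  ≤⟨ +-monoʳ-≤ 2 ih ⟩
    2 + 2 * length xs     ≡⟨ *-suc 2 (length xs) ⟨
    2 * suc (length xs)   ∎
  step (no fx≢0) = begin
    f x + ∑ xs f + 2 * length (filter zero? (x ∷ xs))
      ≡⟨ cong (λ l → f x + ∑ xs f + 2 * length l) (filter-reject zero? fx≢0) ⟩
    f x + ∑ xs f + 2 * z    ≡⟨ +-assoc (f x) _ _ ⟩
    f x + (∑ xs f + 2 * z)  ≤⟨ +-mono-≤ (f≤2 (here refl)) ih ⟩
    2 + 2 * length xs       ≡⟨ *-suc 2 (length xs) ⟨
    2 * suc (length xs)     ∎

length-filter≤2 : {P : A → Set} (P? : Decidable P) {xs : List A} → Unique xs →
  (∀ {a b c} → a ∈ xs → b ∈ xs → c ∈ xs → a ≢ b → a ≢ c → b ≢ c → P a → P b → ¬ P c) →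
  length (filter P? xs) ≤ 2
length-filter≤2 {P = P} P? {xs} u none = go (filter P? xs) (∈-filter⁻ P?) (filter⁺ P? u)
  where
  go : ∀ ys → (∀ {x} → x ∈ ys → x ∈ xs × P x) → Unique ys → length ys ≤ 2
  go []           _ _ = z≤n
  go (_ ∷ [])     _ _ = s≤s z≤n
  go (_ ∷ _ ∷ []) _ _ = s≤s (s≤s z≤n)
  go (a ∷ b ∷ c ∷ _) back ((a≢b ∷ a≢c ∷ _) ∷ (b≢c ∷ _) ∷ _)
    with a∈ , pa ← back (here refl) | b∈ , pb ← back (there (here refl)) | c∈ , pc ← back (there (there (here refl)))
    = contradiction pc (none a∈ b∈ c∈ a≢b a≢c b≢c pa pb)

-- Families of sets and containers

module Families {V X : Set} (_≟_ : DecidableEquality V) (mem : X → V → Bool) where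

  count : X → List V → ℕ
  count x C = ∑ C (λ v → χ (mem x v))

  -- The members of L are distinct sets (mem is membership) which are determined by
  -- their traces on C; each trace has j elements.
  record Family (C : List V) (j : ℕ) (L : List X) : Set where
    field
      unique    : Unique L
      separated : ∀ {x y} → x ∈ L → y ∈ L → (∀ {v} → v ∈ C → mem x v ≡ mem y v) → x ≡ y
      sized     : ∀ {x} → x ∈ L → count x C ≡ j

  open Family

  with-vertex : V → List X → List X
  with-vertex v = filter (λ x → mem x v Bool.≟ true)

  without-vertex : V → List X → List X
  without-vertex v = filter (λ x → mem x v Bool.≟ false)

  in-with : ∀ {v L x} → x ∈ with-vertex v L → x ∈ L × mem x v ≡ true
  in-with {v} = ∈-filter⁻ (λ x → mem x v Bool.≟ true)

  in-without : ∀ {v L x} → x ∈ without-vertex v L → x ∈ L × mem x v ≡ false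
  in-without {v} = ∈-filter⁻ (λ x → mem x v Bool.≟ false)

  Family-filter : ∀ {C j L} {P : X → Set} (P? : Decidable P) → Family C j L → Family C j (filter P? L)
  Family-filter P? F .unique          = filter⁺ P? (unique F)
  Family-filter P? F .separated x∈ y∈ = separated F (proj₁ (∈-filter⁻ P? x∈)) (proj₁ (∈-filter⁻ P? y∈))
  Family-filter P? F .sized x∈        = sized F (proj₁ (∈-filter⁻ P? x∈))

  -- A vertex that lies in no member of `L` affects neither the separation of traces nor their
  -- sizes.
  Family-filter-vertices : ∀ {C j L} {P : V → Set} (P? : Decidable P) →
    (∀ {x v} → x ∈ L → v ∈ C → ¬ P v → mem x v ≡ false) →
    Family C j L → Family (filter P? C) j L
  Family-filter-vertices {C} {j} {L} {P} P? absent F = record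
    { unique    = unique F
    ; separated = λ {x} {y} x∈ y∈ agree → separated F x∈ y∈ λ {v} v∈ → extend x∈ y∈ agree v∈ (P? v)
    ; sized     = λ {x} x∈ → trans (same-count x C (absent x∈)) (sized F x∈)
    }
    where
    extend : ∀ {x y v} → x ∈ L → y ∈ L → (∀ {u} → u ∈ filter P? C → mem x u ≡ mem y u) →
             v ∈ C → Dec (P v) → mem x v ≡ mem y v
    extend x∈ y∈ agree v∈ (yes pv) = agree (∈-filter⁺ P? v∈ pv)
    extend x∈ y∈ agree v∈ (no ¬pv) = trans (absent x∈ v∈ ¬pv) (sym (absent y∈ v∈ ¬pv))
    same-count : ∀ x D → (∀ {v} → v ∈ D → ¬ P v → mem x v ≡ false) → count x (filter P? D) ≡ count x D
    same-count x []      _  = refl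
    same-count x (v ∷ D) ab with P? v
    ... | yes _  = cong (χ (mem x v) +_) (same-count x D (ab ∘ there))
    ... | no ¬pv rewrite ab (here refl) ¬pv = same-count x D (ab ∘ there)

  Family-pick : ∀ {C j L v} → Unique C → v ∈ C → (∀ {x} → x ∈ L → mem x v ≡ true) →
    Family C (suc j) L → Family (_∖_ _≟_ C v) j L
  Family-pick {C} {j} {L} {v} uC v∈ present F = record
    { unique    = unique F
    ; separated = λ {x} {y} x∈ y∈ agree → separated F x∈ y∈ λ {u} u∈ → extend x∈ y∈ agree u∈ (u ≟ v)
    ; sized     = λ {x} x∈ → suc-injective (trans (sym (step x∈)) (sized F x∈))
    }
    where
    extend : ∀ {x y u} → x ∈ L → y ∈ L → (∀ {w} → w ∈ _∖_ _≟_ C v → mem x w ≡ mem y w) →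
             u ∈ C → Dec (u ≡ v) → mem x u ≡ mem y u
    extend x∈ y∈ agree u∈ (yes refl) = trans (present x∈) (sym (present y∈))
    extend x∈ y∈ agree u∈ (no u≢v)   = agree (∈-∖⁺ _≟_ u∈ u≢v)
    step : ∀ {x} → x ∈ L → count x C ≡ suc (count x (_∖_ _≟_ C v))
    step {x} x∈ = trans (∑-∖ _≟_ uC v∈ _) (cong (λ b → χ b + count x (_∖_ _≟_ C v)) (present x∈))

  Family-tail-with : ∀ {v C j L} → (∀ {x} → x ∈ L → mem x v ≡ true) → Family (v ∷ C) (suc j) L → Family C j L
  Family-tail-with {v} {C} present F = record
    { unique    = unique F
    ; separated = λ x∈ y∈ agree → separated F x∈ y∈
        λ { (here refl) → trans (present x∈) (sym (present y∈)) ; (there u∈) → agree u∈ }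
    ; sized     = λ {x} x∈ → suc-injective (trans (cong (λ b → χ b + count x C) (sym (present x∈))) (sized F x∈))
    }

  Family-tail-without : ∀ {v C j L} → (∀ {x} → x ∈ L → mem x v ≡ false) → Family (v ∷ C) j L → Family C j L
  Family-tail-without {v} {C} absent F = record
    { unique    = unique F
    ; separated = λ x∈ y∈ agree → separated F x∈ y∈
        λ { (here refl) → trans (absent x∈) (sym (absent y∈)) ; (there u∈) → agree u∈ }
    ; sized     = λ {x} x∈ → trans (cong (λ b → χ b + count x C) (sym (absent x∈))) (sized F x∈)
    }

  with-vertex-empty : ∀ {C L v} → v ∈ C → Family C 0 L → with-vertex v L ≡ []
  with-vertex-empty {C} {L} {v} v∈ F with with-vertex v L in eq
  ... | []    = refl
  ... | x ∷ _ = contradiction (sized F (proj₁ x∈)) (positive v∈)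
    where
    x∈ : x ∈ L × mem x v ≡ true
    x∈ = in-with (subst (x ∈_) (sym eq) (here refl))
    positive : ∀ {D} → v ∈ D → count x D ≢ 0
    positive (here refl) rewrite proj₂ x∈ = λ ()
    positive {u ∷ D} (there v∈D) e = positive v∈D (m+n≡0⇒n≡0 (χ (mem x u)) e)

  -- Splitting on the first vertex of `C` reproduces Pascal's rule. On the empty `C` all traces
  -- agree, so `separated` leaves at most one member.
  Family-length≤ : ∀ C {j L} → Family C j L → length L ≤ length C choose j
  Family-length≤ [] {j} {[]} F = z≤n
  Family-length≤ [] {zero}  {x ∷ []} F = s≤s z≤n
  Family-length≤ [] {suc j} {x ∷ L} F with () ← sized F (here refl)
  Family-length≤ [] {zero}  {x ∷ y ∷ L} F with (x≢y ∷ _) ∷ _ ← unique F =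
    contradiction (separated F (here refl) (there (here refl)) (λ ())) x≢y
  Family-length≤ (v ∷ C) {zero} {L} F = begin
    length L                                                         ≡⟨ filter-split (λ x → mem x v) L ⟩
    length (with-vertex v L) + length (without-vertex v L)           ≡⟨ cong (λ l → length l + length (without-vertex v L)) (with-vertex-empty (here refl) F) ⟩
    length (without-vertex v L)                                      ≤⟨ Family-length≤ C (Family-tail-without (proj₂ ∘ in-without {L = L}) (Family-filter _ F)) ⟩
    1                                                                ∎
    where open ≤-Reasoning
  Family-length≤ (v ∷ C) {suc j} {L} F = begin
    length L                                                         ≡⟨ filter-split (λ x → mem x v) L ⟩
    length (with-vertex v L) + length (without-vertex v L)           ≤⟨ +-mono-≤
      (Family-length≤ C (Family-tail-with (proj₂ ∘ in-with {L = L}) (Family-filter _ F)))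
      (Family-length≤ C (Family-tail-without (proj₂ ∘ in-without {L = L}) (Family-filter _ F))) ⟩
    (length C choose j) + (length C choose suc j)                    ≡⟨ nCk+nC[k+1]≡[n+1]C[k+1] (length C) j ⟩
    suc (length C) choose suc j                                      ∎
    where open ≤-Reasoning

  -- Double counting of incidences: every trace has at least one element.
  length≤∑-with-vertex : ∀ {C j L} → Family C (suc j) L → length L ≤ ∑ C (λ v → length (with-vertex v L))
  length≤∑-with-vertex {C} {j} {L} F = begin
    length L                                     ≡⟨ *-identityʳ _ ⟨
    length L * 1                                 ≡⟨ ∑-const L 1 ⟨
    ∑ L (λ _ → 1)                                ≤⟨ ∑-mono L (λ x∈ → ≤-trans (s≤s z≤n) (≤-reflexive (sym (sized F x∈)))) ⟩
    ∑ L (λ x → count x C)                        ≡⟨ ∑-swap L C _ ⟩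
    ∑ C (λ v → ∑ L (λ x → χ (mem x v)))          ≡⟨ ∑-cong C (λ v → ∑-cong L (λ x → cong χ (does-≟true (mem x v)))) ⟩
    ∑ C (λ v → ∑ L (λ x → χ (does (mem x v Bool.≟ true)))) ≡⟨ ∑-cong C (λ v → sym (length-filter≡∑ _ L)) ⟩
    ∑ C (λ v → length (with-vertex v L))         ∎
    where
    open ≤-Reasoning
    does-≟true : ∀ b → b ≡ does (b Bool.≟ true)
    does-≟true true  = refl
    does-≟true false = refl

-- Cleared of denominators throughout. As `c ≥ (1 + 1/m) r`, the term `r * s` is at most
-- `s c m / (m + 1)`, so the last hypothesis gives `c′ ≤ (1 - s / (2 (m + 1) r)) c`; by `s-large`
-- the lost proportion is at least `1 / (β + 1)`.
shrink-factor : ∀ r m s β c c′ → 0 < r → suc m * r ≤ m * c → 2 * (suc m * r) ≤ s * suc β →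
  s * c + 2 * (r * c′) ≤ r * s + 2 * (r * c) → suc β * c′ ≤ β * c
shrink-factor r m s β c c′ 0<r c-large s-large shrunk =
  +-cancelʳ-≤ c _ _ (≤-trans final (≤-reflexive (+-comm c (β * c))))
  where
  open ≤-Reasoning
  a = 2 * (suc m * r)
  expand₁ : ∀ m s c r c′ → 2 * (suc m * r) * c′ + s * c + m * s * c ≡ suc m * (s * c + 2 * (r * c′))
  expand₁ = solve-∀
  expand₂ : ∀ m s c r → suc m * (r * s + 2 * (r * c)) ≡ 2 * (suc m * r) * c + s * (suc m * r)
  expand₂ = solve-∀
  expand₃ : ∀ s m c → s * (m * c) ≡ m * s * c
  expand₃ = solve-∀
  scaled : a * c′ + s * c ≤ a * c
  scaled = +-cancelʳ-≤ (m * s * c) _ _ (begin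
    a * c′ + s * c + m * s * c             ≡⟨ expand₁ m s c r c′ ⟩
    suc m * (s * c + 2 * (r * c′))         ≤⟨ *-monoʳ-≤ (suc m) shrunk ⟩
    suc m * (r * s + 2 * (r * c))          ≡⟨ expand₂ m s c r ⟩
    a * c + s * (suc m * r)                ≤⟨ +-monoʳ-≤ (a * c) (*-monoʳ-≤ s c-large) ⟩
    a * c + s * (m * c)                    ≡⟨ cong (a * c +_) (expand₃ s m c) ⟩
    a * c + m * s * c                      ∎)
  expand₄ : ∀ a b c c′ → a * (suc b * c′ + c) ≡ suc b * (a * c′) + a * c
  expand₄ = solve-∀
  expand₅ : ∀ a b s c c′ → suc b * (a * c′) + s * suc b * c ≡ suc b * (a * c′ + s * c)
  expand₅ = solve-∀
  expand₆ : ∀ a b c → suc b * (a * c) ≡ a * (c + b * c)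
  expand₆ = solve-∀
  final : suc β * c′ + c ≤ c + β * c
  final = *-cancelˡ-≤ a {{>-nonZero (*-mono-≤ {1} {2} (s≤s z≤n) (*-mono-≤ {1} {suc m} (s≤s z≤n) 0<r))}} (begin
    a * (suc β * c′ + c)                ≡⟨ expand₄ a β c c′ ⟩
    suc β * (a * c′) + a * c            ≤⟨ +-monoʳ-≤ (suc β * (a * c′)) (*-monoˡ-≤ c s-large) ⟩
    suc β * (a * c′) + s * suc β * c    ≡⟨ expand₅ a β s c c′ ⟩
    suc β * (a * c′ + s * c)            ≤⟨ *-monoʳ-≤ (suc β) scaled ⟩
    suc β * (a * c)                     ≡⟨ expand₆ a β c ⟩
    a * (c + β * c)                     ∎)

-- cls s u stands for the direction in which u is seen from s; cls-exchange says that
-- collinearity of three distinct points does not depend on the point of view.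
module Containers {V X : Set} (_≟ⱽ_ : DecidableEquality V) (mem : X → V → Bool)
  {r : ℕ} (cls : V → V → Fin r)
  (cls-exchange : ∀ {s u v} → s ≢ u → s ≢ v → u ≢ v → cls s u ≡ cls s v → cls u s ≡ cls u v)
  where

  open Families _≟ⱽ_ mem
  open Family

  infixl 6 _-_
  _-_ : List V → V → List V
  _-_ = _∖_ _≟ⱽ_

  -- Stated for a predicate so that it covers both an arc and the seed inside it.
  NoThree : (V → Set) → Set
  NoThree P = ∀ {a b c} → P a → P b → P c → a ≢ b → a ≢ c → b ≢ c → cls a b ≢ cls a c

  Arc : X → Set
  Arc x = NoThree (λ v → mem x v ≡ true)

  -- For distinct `v` and `u` outside `S`, the multiplicity of the edge joining them: the number of
  -- seed points on their line. At `u = v` it degenerates to `length S`.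
  hits : List V → V → V → ℕ
  hits S v u = length (filter (λ s → cls s v Fin.≟ cls s u) S)

  survivors : List V → List V → V → List V
  survivors S C v = filter (λ u → hits S v u ≟ 0) (C - v)

  -- Three seed points each seeing `v` and `u` in one direction would all lie on the line `vu`:
  -- `toward` turns the direction from `a` to `v` into that from `a` to another seed point, against
  -- `cap`.
  hits≤2 : ∀ {S v u} → Unique S → NoThree (_∈ S) → v ∉ S → u ∉ S → v ≢ u → hits S v u ≤ 2
  hits≤2 {S} {v} {u} uS cap v∉S u∉S v≢u = length-filter≤2 _ uS
    λ a∈ b∈ c∈ a≢b a≢c b≢c pa pb pc →
      cap a∈ b∈ c∈ a≢b a≢c b≢c
        (trans (sym (toward a∈ b∈ a≢b pa pb)) (toward a∈ c∈ a≢c pa pc))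
    where
    off : ∀ {a w} → w ∉ S → a ∈ S → a ≢ w
    off w∉ a∈ refl = w∉ a∈
    toward : ∀ {a b} → a ∈ S → b ∈ S → a ≢ b → cls a v ≡ cls a u → cls b v ≡ cls b u → cls a v ≡ cls a b
    toward a∈ b∈ a≢b pa pb = cls-exchange (≢-sym (off v∉S a∈)) (≢-sym (off v∉S b∈)) a≢b
      (trans (cls-exchange (off v∉S a∈) (off u∉S a∈) v≢u pa)
             (sym (cls-exchange (off v∉S b∈) (off u∉S b∈) v≢u pb)))

  -- Averaging over `C`: by `monochromatic-pairs` each seed point sees at least `|C|² / r` ordered
  -- pairs in a common direction, and interchanging the sums distributes these pairs over their
  -- first vertices.
  heavy-vertex : ∀ S C → 0 < length C →
    ∃ λ v → v ∈ C × length S * length C ≤ r * ∑ C (hits S v)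
  heavy-vertex S C 0<C = ∑-pigeonhole C (λ v → r * ∑ C (hits S v)) (length S * length C) 0<C (begin
    length C * (length S * length C)                ≡⟨ swap (length C) (length S) ⟩
    length S * (length C * length C)                ≡⟨ ∑-const S _ ⟨
    ∑ S (λ _ → length C * length C)                 ≤⟨ ∑-mono S (λ {s} _ → monochromatic-pairs (cls s) C) ⟩
    ∑ S (λ s → r * ∑ C (λ v → ∑ C (λ u → h s v u))) ≡⟨ ∑-*ˡ S r _ ⟩
    r * ∑ S (λ s → ∑ C (λ v → ∑ C (λ u → h s v u))) ≡⟨ cong (r *_) (∑-swap S C _) ⟩
    r * ∑ C (λ v → ∑ S (λ s → ∑ C (λ u → h s v u))) ≡⟨ cong (r *_) (∑-cong C (λ v → ∑-swap S C _)) ⟩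
    r * ∑ C (λ v → ∑ C (λ u → ∑ S (λ s → h s v u))) ≡⟨ cong (r *_) (∑-cong C (λ v → ∑-cong C (λ u → sym (length-filter≡∑ _ S)))) ⟩
    r * ∑ C (λ v → ∑ C (hits S v))                  ≡⟨ ∑-*ˡ C r _ ⟨
    ∑ C (λ v → r * ∑ C (hits S v))                  ∎)
    where
    open ≤-Reasoning
    swap : ∀ c s → c * (s * c) ≡ s * (c * c)
    swap = solve-∀
    h : V → V → V → ℕ
    h s v u = χ (does (cls s v Fin.≟ cls s u))

  -- In the sum of `hits S v` over `C`, the diagonal entry is at most `length S`, every other entry
  -- is at most 2 by `hits≤2`, and the survivors are the off-diagonal zeros.
  survivors-bound : ∀ {S C v} → Unique S → NoThree (_∈ S) → Unique C → (∀ {u} → u ∈ C → u ∉ S) → v ∈ C →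
    length S * length C ≤ r * ∑ C (hits S v) →
    length S * length C + 2 * (r * length (survivors S C v)) ≤ r * length S + 2 * (r * length C)
  survivors-bound {S} {C} {v} uS cap uC C∌S v∈ heavy = begin
    length S * length C + 2 * (r * c′)              ≤⟨ +-monoˡ-≤ _ heavy ⟩
    r * ∑ C (hits S v) + 2 * (r * c′)               ≡⟨ cong (λ z → r * z + 2 * (r * c′)) (∑-∖ _≟ⱽ_ uC v∈ (hits S v)) ⟩
    r * (hits S v v + rest) + 2 * (r * c′)          ≡⟨ regroup r (hits S v v) rest c′ ⟩
    r * hits S v v + r * (rest + 2 * c′)            ≤⟨ +-mono-≤ (*-monoʳ-≤ r (length-filter _ S)) (*-monoʳ-≤ r others) ⟩
    r * length S + r * (2 * length (C - v))         ≤⟨ +-monoʳ-≤ (r * length S) (*-monoʳ-≤ r (*-monoʳ-≤ 2 (length-filter _ C))) ⟩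
    r * length S + r * (2 * length C)               ≡⟨ cong (r * length S +_) (swap r (length C)) ⟩
    r * length S + 2 * (r * length C)               ∎
    where
    open ≤-Reasoning
    c′ = length (survivors S C v)
    rest = ∑ (C - v) (hits S v)
    regroup : ∀ r a b c → r * (a + b) + 2 * (r * c) ≡ r * a + r * (b + 2 * c)
    regroup = solve-∀
    swap : ∀ r c → r * (2 * c) ≡ 2 * (r * c)
    swap = solve-∀
    others : rest + 2 * c′ ≤ 2 * length (C - v)
    others = ∑-filter-zeros (hits S v) (C - v) λ u∈ → let u∈C , u≢v = ∈-∖⁻ _≟ⱽ_ C u∈ in
      hits≤2 uS cap (C∌S v∈) (C∌S u∈C) (≢-sym u≢v)

  -- S is the part of the arcs fixed so far, C contains what may still be added.
  record Config (S C : List V) (j : ℕ) (L : List X) : Set where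
    field
      S-unique : Unique S
      C-unique : Unique C
      disjoint : ∀ {v} → v ∈ C → v ∉ S
      family   : Family C j L
      arcs     : ∀ {x} → x ∈ L → Arc x
      contains : ∀ {x s} → x ∈ L → s ∈ S → mem x s ≡ true

  open Config

  no-three : ∀ {S C j L x} → Config S C j L → x ∈ L → NoThree (_∈ S)
  no-three K x∈ a∈ b∈ c∈ = arcs K x∈ (contains K x∈ a∈) (contains K x∈ b∈) (contains K x∈ c∈)

  delete : ∀ {S C j L} v → Config S C j L → Config S (C - v) j (without-vertex v L)
  delete {S} {C} {j} {L} v K = record
    { S-unique = S-unique K
    ; C-unique = filter⁺ _ (C-unique K)
    ; disjoint = disjoint K ∘ proj₁ ∘ ∈-∖⁻ _≟ⱽ_ C
    ; family   = Family-filter-vertices (λ u → ¬? (u ≟ⱽ v)) absent (Family-filter _ (family K))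
    ; arcs     = arcs K ∘ proj₁ ∘ in-without
    ; contains = contains K ∘ proj₁ ∘ in-without
    }
    where
    absent : ∀ {x u} → x ∈ without-vertex v L → u ∈ C → ¬ (u ≢ v) → mem x u ≡ false
    absent {u = u} x∈ _ ¬u≢v with u ≟ⱽ v
    ... | yes refl = proj₂ (in-without {L = L} x∈)
    ... | no u≢v   = contradiction u≢v ¬u≢v

  hits-witness : ∀ S {v u} → hits S v u ≢ 0 → ∃ λ s → s ∈ S × cls s v ≡ cls s u
  hits-witness []      h = contradiction refl h
  hits-witness (s ∷ S) {v} {u} h with cls s v Fin.≟ cls s u
  ... | yes e = s , here refl , e
  ... | no _ with t , t∈ , e ← hits-witness S h = t , there t∈ , e

  -- An arc through `v` and a seed point contains no third point of their line, so only
  -- non-neighbours of `v` remain candidates.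
  choose-survivors : ∀ {S C j L v} → v ∈ C → Config S C (suc j) L →
    Config S (survivors S C v) j (with-vertex v L)
  choose-survivors {S} {C} {j} {L} {v} v∈ K = record
    { S-unique = S-unique K
    ; C-unique = filter⁺ _ (filter⁺ _ (C-unique K))
    ; disjoint = λ u∈ → disjoint K (proj₁ (∈-∖⁻ _≟ⱽ_ C (proj₁ (∈-filter⁻ (λ u → hits S v u ≟ 0) u∈))))
    ; family   = Family-filter-vertices (λ u → hits S v u ≟ 0) absent
                   (Family-pick (C-unique K) v∈ (proj₂ ∘ in-with {L = L}) (Family-filter _ (family K)))
    ; arcs     = arcs K ∘ proj₁ ∘ in-with
    ; contains = contains K ∘ proj₁ ∘ in-with
    }
    where
    absent : ∀ {x u} → x ∈ with-vertex v L → u ∈ C - v → hits S v u ≢ 0 → mem x u ≡ false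
    absent {x} {u} x∈ u∈ h with mem x u in xu
    ... | false = refl
    ... | true with x∈L , xv ← in-with {L = L} x∈ | u∈C , u≢v ← ∈-∖⁻ _≟ⱽ_ C u∈ | s , s∈ , e ← hits-witness S h =
      contradiction e (arcs K x∈L (contains K x∈L s∈) xv xu
        (λ { refl → disjoint K v∈ s∈ }) (λ { refl → disjoint K u∈C s∈ }) (≢-sym u≢v))

  extend-seed : ∀ {S C j L v} → v ∈ C → Config S C (suc j) L → Config (v ∷ S) (C - v) j (with-vertex v L)
  extend-seed {S} {C} {j} {L} {v} v∈ K = record
    { S-unique = All.tabulate (λ { s∈ refl → disjoint K v∈ s∈ }) ∷ S-unique K
    ; C-unique = filter⁺ _ (C-unique K)
    ; disjoint = λ { u∈ (here refl) → proj₂ (∈-∖⁻ _≟ⱽ_ C u∈) refl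
                   ; u∈ (there u∈S) → disjoint K (proj₁ (∈-∖⁻ _≟ⱽ_ C u∈)) u∈S }
    ; family   = Family-pick (C-unique K) v∈ (proj₂ ∘ in-with {L = L}) (Family-filter _ (family K))
    ; arcs     = arcs K ∘ proj₁ ∘ in-with
    ; contains = λ { x∈ (here refl) → proj₂ (in-with {L = L} x∈)
                   ; x∈ (there s∈)  → contains K (proj₁ (in-with x∈)) s∈ }
    }

  -- `n` bounds the vertex set and `M` is the size at which branching stops. `M-large` and `s-large`
  -- make each positive answer shrink `C` by the factor `β / (β + 1)`, so by `T-large` at most `T`
  -- of them lead from `n` points down to `q`. `Q` pays for the choice of a vertex and the factor
  -- `k` lost in `shorter`.
  module Bound (n q k m M s β T Q : ℕ) (q≤M : q ≤ M) (k≤M : k ≤ M) (0<r : 0 < r)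
    (M-large : ∀ c → M < c → suc m * r ≤ m * c)
    (s-large : 2 * (suc m * r) ≤ s * suc β)
    (Q-large : 1 + n * k ≤ Q)
    (T-large : n * β ^ T ≤ q * suc β ^ T)
    where

    open ≤-Reasoning

    instance
      Q≢0 : NonZero Q
      Q≢0 = >-nonZero (≤-trans (s≤s z≤n) Q-large)

    shorter : ∀ {j} → suc j ≤ k → M choose j ≤ k * (M choose suc j)
    shorter {j} j<k = ≤-trans (choose-pred≤ j (≤-trans j<k k≤M)) (*-monoˡ-≤ (M choose suc j) j<k)

    -- t bounds the number of vertices that can still be chosen before |C| ≤ q.
    container : ∀ t {S C j L} → Config S C j L → length S ≡ s → length C ≤ n → j ≤ k →
      length C * β ^ t ≤ q * suc β ^ t → length L ≤ Q ^ t * (M choose j)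
    container zero {S} {C} {j} {L} K _ _ _ few = begin
      length L               ≤⟨ Family-length≤ C (family K) ⟩
      length C choose j      ≤⟨ choose-monoˡ j (≤-trans (*-cancelʳ-≤ (length C) q 1 few) q≤M) ⟩
      M choose j             ≡⟨ *-identityˡ _ ⟨
      1 * (M choose j)       ∎
    container (suc t) {S} {C₀} {j₀} {L₀} K₀ |S|≡s C₀≤n j₀≤k few₀ = begin
      length L₀                                        ≤⟨ go (length C₀) K₀ j₀≤k C₀≤n few₀ ≤-refl ⟩
      (1 + length C₀ * (k * Q ^ t)) * (M choose j₀)    ≤⟨ *-monoˡ-≤ (M choose j₀) absorb ⟩
      Q ^ suc t * (M choose j₀)                        ∎
      where
      regroup : ∀ n k z → z + n * (k * z) ≡ (1 + n * k) * z
      regroup = solve-∀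
      absorb : 1 + length C₀ * (k * Q ^ t) ≤ Q ^ suc t
      absorb = begin
        1 + length C₀ * (k * Q ^ t)  ≤⟨ +-mono-≤ (m^n>0 Q t) (*-monoˡ-≤ (k * Q ^ t) C₀≤n) ⟩
        Q ^ t + n * (k * Q ^ t)      ≡⟨ regroup n k (Q ^ t) ⟩
        (1 + n * k) * Q ^ t          ≤⟨ *-monoˡ-≤ (Q ^ t) Q-large ⟩
        Q * Q ^ t                    ∎

      -- Follows the negative answers with `t` fixed. Deleting `v` lowers `c`, and each of the at
      -- most `c` vertices met contributes one positive branch of size at most
      -- `k * Q ^ t * (M choose j)`. The summand 1 is the final leaf, where `length C ≤ M`.
      go : ∀ c {C j L} → Config S C j L → j ≤ k → length C ≤ n →
        length C * β ^ suc t ≤ q * suc β ^ suc t → length C ≤ c →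
        length L ≤ (1 + c * (k * Q ^ t)) * (M choose j)
      go c {C} {j} {L} K j≤k C≤n few C≤c with length C ≤? M
      ... | yes C≤M = begin
        length L            ≤⟨ Family-length≤ C (family K) ⟩
        length C choose j   ≤⟨ choose-monoˡ j C≤M ⟩
        M choose j          ≤⟨ m≤m+n (M choose j) _ ⟩
        (1 + c * (k * Q ^ t)) * (M choose j) ∎
      go zero    {L = L}     K j≤k C≤n few C≤c | no C≰M = contradiction (≤-trans C≤c z≤n) C≰M
      -- The empty `L` is split off because `no-three` needs an arc that contains the seed.
      go (suc c) {L = []}    K j≤k C≤n few C≤c | no C≰M = z≤n
      go (suc c) {C} {j} {L = L@(_ ∷ _)} K j≤k C≤n few C≤c | no C≰M
        with v , v∈ , heavy ← heavy-vertex S C (≤-trans (s≤s z≤n) (≰⇒> C≰M)) = begin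
        length L                                                 ≡⟨ filter-split (λ x → mem x v) L ⟩
        length (with-vertex v L) + length (without-vertex v L)   ≤⟨ +-mono-≤ (with-bound j≤k K)
            (go c (delete v K) j≤k (≤-trans fewer C≤n) (≤-trans (*-monoˡ-≤ _ fewer) few) (s≤s⁻¹ (≤-trans (≤-reflexive (sym C≡)) C≤c))) ⟩
        k * Q ^ t * (M choose j) + (1 + c * (k * Q ^ t)) * (M choose j)
                                                                 ≡⟨ collect (k * Q ^ t) (M choose j) c ⟩
        (1 + suc c * (k * Q ^ t)) * (M choose j)                 ∎
        where
        collect : ∀ a b c → a * b + (1 + c * a) * b ≡ (1 + suc c * a) * b
        collect = solve-∀
        C≡ : length C ≡ 1 + length (C - v)
        C≡ = length-∖ _≟ⱽ_ (C-unique K) v∈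
        fewer : length (C - v) ≤ length C
        fewer = length-filter _ C
        C′ = survivors S C v
        shrunk : suc β * length C′ ≤ β * length C
        shrunk = shrink-factor r m s β (length C) (length C′) 0<r (M-large _ (≰⇒> C≰M)) s-large
          (subst (λ z → z * length C + 2 * (r * length C′) ≤ r * z + 2 * (r * length C)) |S|≡s
            (survivors-bound (S-unique K) (no-three K (here refl)) (C-unique K) (disjoint K) v∈ heavy))
        few′ : length C′ * β ^ t ≤ q * suc β ^ t
        few′ = *-cancelˡ-≤ (suc β) (begin
          suc β * (length C′ * β ^ t)   ≡⟨ *-assoc (suc β) (length C′) (β ^ t) ⟨
          suc β * length C′ * β ^ t     ≤⟨ *-monoˡ-≤ (β ^ t) shrunk ⟩
          β * length C * β ^ t          ≡⟨ rearrange β (length C) (β ^ t) ⟩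
          length C * (β * β ^ t)        ≤⟨ few ⟩
          q * (suc β * suc β ^ t)       ≡⟨ rearrange′ q (suc β) (suc β ^ t) ⟩
          suc β * (q * suc β ^ t)       ∎)
          where
          rearrange : ∀ a b c → a * b * c ≡ b * (a * c)
          rearrange = solve-∀
          rearrange′ : ∀ a b c → a * (b * c) ≡ b * (a * c)
          rearrange′ = solve-∀
        with-bound : ∀ {j} → j ≤ k → Config S C j L → length (with-vertex v L) ≤ k * Q ^ t * (M choose j)
        with-bound {zero}  _   K = ≤-trans (≤-reflexive (cong length (with-vertex-empty v∈ (family K)))) z≤n
        with-bound {suc j} j<k K = begin
          length (with-vertex v L)              ≤⟨ container t (choose-survivors v∈ K) |S|≡s
                                                     (≤-trans (length-filter _ (C - v)) (≤-trans fewer C≤n)) (<⇒≤ j<k) few′ ⟩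
          Q ^ t * (M choose j)                  ≤⟨ *-monoʳ-≤ (Q ^ t) (shorter j<k) ⟩
          Q ^ t * (k * (M choose suc j))        ≡⟨ rotate (Q ^ t) k (M choose suc j) ⟩
          k * Q ^ t * (M choose suc j)          ∎
          where
          rotate : ∀ a b c → a * (b * c) ≡ b * a * c
          rotate = solve-∀

    -- A union bound over the next seed vertex: each of the `i` missing ones costs a factor
    -- `n * k ≤ Q`, with `i ≤ j` ensuring that the traces still have elements to choose. Once `s`
    -- are fixed, `container` takes over.
    seeds : ∀ i {S C j L} → Config S C j L → i + length S ≡ s → length C ≤ n → i ≤ j → j ≤ k →
      length L ≤ Q ^ (i + T) * (M choose j)
    seeds zero    K |S|≡s C≤n _ j≤k = container T K |S|≡s C≤n j≤k (≤-trans (*-monoˡ-≤ (β ^ T) C≤n) T-large)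
    seeds (suc i) {S} {C} {suc j} {L} K |S|≡s C≤n (s≤s i≤j) j<k = begin
      length L                                      ≤⟨ length≤∑-with-vertex (family K) ⟩
      ∑ C (λ v → length (with-vertex v L))          ≤⟨ ∑-mono C (λ {v} v∈ → seeds i (extend-seed v∈ K) (trans (+-suc i (length S)) |S|≡s)
                                                                    (≤-trans (length-filter _ C) C≤n) i≤j (<⇒≤ j<k)) ⟩
      ∑ C (λ _ → Q ^ (i + T) * (M choose j))        ≡⟨ ∑-const C _ ⟩
      length C * (Q ^ (i + T) * (M choose j))       ≤⟨ *-mono-≤ C≤n (*-monoʳ-≤ (Q ^ (i + T)) (shorter j<k)) ⟩
      n * (Q ^ (i + T) * (k * (M choose suc j)))    ≡⟨ rotate n (Q ^ (i + T)) k (M choose suc j) ⟩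
      n * k * Q ^ (i + T) * (M choose suc j)        ≤⟨ *-monoˡ-≤ (M choose suc j) (*-monoˡ-≤ (Q ^ (i + T)) (≤-trans (n≤1+n _) Q-large)) ⟩
      Q ^ (suc i + T) * (M choose suc j)            ∎
      where
      rotate : ∀ n z k b → n * (z * (k * b)) ≡ n * k * z * b
      rotate = solve-∀

-- Directions in the affine plane

∑-++ : (xs ys : List A) (f : A → ℕ) → ∑ (xs ++ ys) f ≡ ∑ xs f + ∑ ys f
∑-++ []       ys f = refl
∑-++ (x ∷ xs) ys f = trans (cong (f x +_) (∑-++ xs ys f)) (sym (+-assoc (f x) _ _))

∑-map : (g : A → B) (xs : List A) (f : B → ℕ) → ∑ (List.map g xs) f ≡ ∑ xs (f ∘ g)
∑-map g []       f = refl
∑-map g (x ∷ xs) f = cong (f (g x) +_) (∑-map g xs f)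

∑-cartesianProduct : (xs : List A) (ys : List B) (f : A × B → ℕ) →
  ∑ (cartesianProduct xs ys) f ≡ ∑ xs (λ x → ∑ ys (λ y → f (x , y)))
∑-cartesianProduct []       ys f = refl
∑-cartesianProduct (x ∷ xs) ys f =
  trans (∑-++ (List.map (x ,_) ys) _ f) (cong₂ _+_ (∑-map (x ,_) ys f) (∑-cartesianProduct xs ys f))

∑-lookup : ∀ {n} (v : Vec A n) (f : A → ℕ) → ∑ (allFin n) (λ i → f (lookup v i)) ≡ Vec.sum (Vec.map f v)
∑-lookup v f = go v id (λ i → f (lookup v i)) (λ _ → refl)
  where
  -- The index map `ι` is generalised because `allFin` is a `tabulate`, whose recursion composes it
  -- with `suc`.
  go : ∀ {n} (w : Vec _ n) {I : Set} (ι : Fin n → I) (g : I → ℕ) → (∀ i → g (ι i) ≡ f (lookup w i)) →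
       ∑ (tabulate ι) g ≡ Vec.sum (Vec.map f w)
  go []      ι g e = refl
  go (a ∷ w) ι g e = cong₂ _+_ (e zero) (go w (ι ∘ suc) g (e ∘ suc))

∣∣≡sum : ∀ {n} (p : Subset n) → ∣ p ∣ ≡ Vec.sum (Vec.map χ p)
∣∣≡sum []          = refl
∣∣≡sum (true ∷ p)  = cong suc (∣∣≡sum p)
∣∣≡sum (false ∷ p) = ∣∣≡sum p

lookup-injective : ∀ {n} {v w : Vec A n} → (∀ i → lookup v i ≡ lookup w i) → v ≡ w
lookup-injective {v = []}    {[]}    e = refl
lookup-injective {v = _ ∷ _} {_ ∷ _} e = cong₂ _∷_ (e zero) (lookup-injective (e ∘ suc))

mem : ∀ {q} → PointSet q → Fin q × Fin q → Bool
mem P (x , y) = lookup (lookup P x) y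

points : ∀ q → List (Fin q × Fin q)
points q = cartesianProduct (allFin q) (allFin q)

points-unique : ∀ q → Unique (points q)
points-unique q = cartesianProduct⁺ (allFin⁺ q) (allFin⁺ q)

∈-points : ∀ {q} (p : Fin q × Fin q) → p ∈ points q
∈-points (x , y) = ∈-cartesianProduct⁺ (∈-allFin x) (∈-allFin y)

length-points : ∀ q → length (points q) ≡ q * q
length-points q = begin
  length (points q)                              ≡⟨ *-identityʳ _ ⟨
  length (points q) * 1                          ≡⟨ ∑-const (points q) 1 ⟨
  ∑ (points q) (λ _ → 1)                         ≡⟨ ∑-cartesianProduct (allFin q) (allFin q) _ ⟩
  ∑ (allFin q) (λ _ → ∑ (allFin q) (λ _ → 1))    ≡⟨ ∑-const (allFin q) _ ⟩
  length (allFin q) * ∑ (allFin q) (λ _ → 1)     ≡⟨ cong (length (allFin q) *_) (trans (∑-const (allFin q) 1) (*-identityʳ _)) ⟩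
  length (allFin q) * length (allFin q)          ≡⟨ cong (λ n → n * n) (length-tabulate {n = q} id) ⟩
  q * q                                          ∎
  where open ≡-Reasoning

size≡∑ : ∀ {q} (P : PointSet q) → ∑ (points q) (χ ∘ mem P) ≡ size P
size≡∑ {q} P = begin
  ∑ (points q) (χ ∘ mem P)                                         ≡⟨ ∑-cartesianProduct (allFin q) (allFin q) _ ⟩
  ∑ (allFin q) (λ x → ∑ (allFin q) (λ y → χ (lookup (lookup P x) y))) ≡⟨ ∑-cong (allFin q) (λ x → trans (∑-lookup (lookup P x) χ) (sym (∣∣≡sum (lookup P x)))) ⟩
  ∑ (allFin q) (λ x → ∣ lookup P x ∣)                              ≡⟨ ∑-lookup P ∣_∣ ⟩
  size P                                                           ∎
  where open ≡-Reasoning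

module Plane {q : ℕ} (F : FiniteField q) where
  open FiniteField F

  R : CommutativeRing _ _
  R = record { isCommutativeRing = isCommutativeRing }

  module 𝔽 = CommutativeRing R
  open Algebra.Properties.Ring 𝔽.ring using (-1*x≈-x; -‿distribʳ-*; +-cancelˡ; -‿injective)
  open Algebra.Properties.Group 𝔽.+-group using (x∙y⁻¹≈ε⇒x≈y)
  open ≡-Reasoning

  Pt : Set
  Pt = Fin q × Fin q

  -- Passes between the slope equation `m x - m x₀ = y - y₀` and the intercept equation
  -- `m x - y = m x₀ - y₀`; the same exchange serves both directions.
  exchange-differences : ∀ {a b c d} → a +F (-F b) ≡ c +F (-F d) → a +F (-F c) ≡ b +F (-F d)
  exchange-differences {a} {b} {c} {d} e = begin
    a +F (-F c)                                    ≡⟨ cong (_+F (-F c)) a≡ ⟩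
    (c +F (b +F (-F d))) +F (-F c)                 ≡⟨ cong (_+F (-F c)) (𝔽.+-comm c _) ⟩
    ((b +F (-F d)) +F c) +F (-F c)                 ≡⟨ 𝔽.+-assoc _ c _ ⟩
    (b +F (-F d)) +F (c +F (-F c))                 ≡⟨ cong ((b +F (-F d)) +F_) (𝔽.-‿inverseʳ c) ⟩
    (b +F (-F d)) +F 0F                            ≡⟨ 𝔽.+-identityʳ _ ⟩
    b +F (-F d)                                    ∎
    where
    a≡ : a ≡ c +F (b +F (-F d))
    a≡ = begin
      a                                            ≡⟨ 𝔽.+-identityʳ a ⟨
      a +F 0F                                      ≡⟨ cong (a +F_) (𝔽.-‿inverseˡ b) ⟨
      a +F ((-F b) +F b)                           ≡⟨ 𝔽.+-assoc a _ b ⟨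
      (a +F (-F b)) +F b                           ≡⟨ cong (_+F b) e ⟩
      (c +F (-F d)) +F b                           ≡⟨ 𝔽.+-assoc c _ b ⟩
      c +F ((-F d) +F b)                           ≡⟨ cong (c +F_) (𝔽.+-comm _ b) ⟩
      c +F (b +F (-F d))                           ∎

  -- Up to sign the usual intercept of the line of slope `m`. The second term is a product with
  -- `-F 1F` so that `OnLine` holds by computation for the line with coefficients `m` and `-F 1F`.
  intercept : Fin q → Pt → Fin q
  intercept m (x , y) = (m *F x) +F ((-F 1F) *F y)

  intercept≡ : ∀ m x y → intercept m (x , y) ≡ (m *F x) +F (-F y)
  intercept≡ m x y = cong ((m *F x) +F_) (-1*x≈-x y)

  *-distrib-difference : ∀ m x x₀ → m *F (x +F (-F x₀)) ≡ (m *F x) +F (-F (m *F x₀))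
  *-distrib-difference m x x₀ = trans (𝔽.distribˡ m x _) (cong ((m *F x) +F_) (sym (-‿distribʳ-* m x₀)))

  difference≢0 : ∀ {x x₀} → x ≢ x₀ → (x +F (-F x₀)) ≢ 0F
  difference≢0 x≢ e = x≢ (x∙y⁻¹≈ε⇒x≈y _ _ e)

  inv : ∀ {x x₀} → x ≢ x₀ → Fin q
  inv x≢ = proj₁ (inverse _ (difference≢0 x≢))

  inv-inverse : ∀ {x x₀} (x≢ : x ≢ x₀) → (x +F (-F x₀)) *F inv x≢ ≡ 1F
  inv-inverse x≢ = proj₂ (inverse _ (difference≢0 x≢))

  -- `zero` is the vertical direction and `suc m` the slope `m`. At `u = s` the value `zero` is a
  -- default.
  direction : (s u : Pt) → Dec (proj₁ u ≡ proj₁ s) → Fin (suc q)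
  direction s         u       (yes _)  = zero
  direction (x₀ , y₀) (x , y) (no x≢) = suc ((y +F (-F y₀)) *F inv x≢)

  cls : Pt → Pt → Fin (suc q)
  cls s u = direction s u (proj₁ u Fin.≟ proj₁ s)

  -- A division-free form of `cls s u ≡ l`; `cls-correct` and `cls-unique` give the two
  -- implications.
  InDirection : Pt → Pt → Fin (suc q) → Set
  InDirection s u zero    = proj₁ u ≡ proj₁ s
  InDirection s u (suc m) = proj₁ u ≢ proj₁ s × intercept m u ≡ intercept m s

  cls-correct : ∀ s u → InDirection s u (cls s u)
  cls-correct s@(x₀ , y₀) u@(x , y) with x Fin.≟ x₀
  ... | yes e  = e
  ... | no x≢ = x≢ , (begin
    intercept m u                ≡⟨ intercept≡ m x y ⟩
    (m *F x) +F (-F y)           ≡⟨ exchange-differences (trans (sym (*-distrib-difference m x x₀)) m*d) ⟩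
    (m *F x₀) +F (-F y₀)         ≡⟨ intercept≡ m x₀ y₀ ⟨
    intercept m s                ∎)
    where
    m = (y +F (-F y₀)) *F inv x≢
    m*d : m *F (x +F (-F x₀)) ≡ y +F (-F y₀)
    m*d = begin
      m *F (x +F (-F x₀))                              ≡⟨ 𝔽.*-assoc _ (inv x≢) _ ⟩
      (y +F (-F y₀)) *F (inv x≢ *F (x +F (-F x₀)))     ≡⟨ cong ((y +F (-F y₀)) *F_) (trans (𝔽.*-comm (inv x≢) _) (inv-inverse x≢)) ⟩
      (y +F (-F y₀)) *F 1F                             ≡⟨ 𝔽.*-identityʳ _ ⟩
      y +F (-F y₀)                                     ∎

  cls-unique : ∀ s u l → InDirection s u l → cls s u ≡ l
  cls-unique (x₀ , y₀) (x , y) zero e with x Fin.≟ x₀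
  ... | yes _  = refl
  ... | no x≢ = contradiction e x≢
  cls-unique (x₀ , y₀) (x , y) (suc m) (x≢′ , e) with x Fin.≟ x₀
  ... | yes x≡ = contradiction x≡ x≢′
  ... | no x≢ = cong suc (begin
    (y +F (-F y₀)) *F inv x≢               ≡⟨ cong (_*F inv x≢) (exchange-differences (trans (sym (intercept≡ m x y)) (trans e (intercept≡ m x₀ y₀)))) ⟨
    ((m *F x) +F (-F (m *F x₀))) *F inv x≢ ≡⟨ cong (_*F inv x≢) (*-distrib-difference m x x₀) ⟨
    (m *F (x +F (-F x₀))) *F inv x≢        ≡⟨ 𝔽.*-assoc m _ _ ⟩
    m *F ((x +F (-F x₀)) *F inv x≢)        ≡⟨ cong (m *F_) (inv-inverse x≢) ⟩
    m *F 1F                                ≡⟨ 𝔽.*-identityʳ m ⟩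
    m                                      ∎)

  intercept-injective : ∀ m x {y y′} → intercept m (x , y) ≡ intercept m (x , y′) → y ≡ y′
  intercept-injective m x {y} {y′} e =
    -‿injective (+-cancelˡ (m *F x) _ _ (trans (sym (intercept≡ m x y)) (trans e (intercept≡ m x y′))))

  InDirection-exchange : ∀ {s u v} l → u ≢ v → InDirection s u l → InDirection s v l →
    InDirection u s l × InDirection u v l
  InDirection-exchange zero    u≢v p p′ = sym p , trans p′ (sym p)
  InDirection-exchange {s} {u} {v} (suc m) u≢v (x≢ , p) (x≢′ , p′) = (≢-sym x≢ , sym p) , distinct , trans p′ (sym p)
    where
    -- On a line of slope `m` the abscissa determines the point, so equal abscissae would force
    -- `u ≡ v`.
    distinct : proj₁ v ≢ proj₁ u
    distinct refl = u≢v (cong (proj₁ u ,_) (intercept-injective m (proj₁ u) (trans p (sym p′))))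

  cls-exchange : ∀ {s u v} → s ≢ u → s ≢ v → u ≢ v → cls s u ≡ cls s v → cls u s ≡ cls u v
  cls-exchange {s} {u} {v} _ _ u≢v e
    with p , p′ ← InDirection-exchange {s} {u} {v} (cls s u) u≢v (cls-correct s u) (subst (InDirection s v) (sym e) (cls-correct s v))
    = trans (cls-unique u s (cls s u) p) (sym (cls-unique u v (cls s u) p′))

  line : Pt → Fin (suc q) → Line F
  line s zero    = record { a = 1F ; b = 0F ; c = proj₁ s ; nondeg = λ (1≡0 , _) → 0≢1 (sym 1≡0) }
  line s (suc m) = record { a = m ; b = -F 1F ; c = intercept m s ; nondeg = λ (_ , -1≡0) → 0≢1 (begin
    0F                ≡⟨ 𝔽.-‿inverseʳ 1F ⟨
    1F +F (-F 1F)     ≡⟨ cong (1F +F_) -1≡0 ⟩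
    1F +F 0F          ≡⟨ 𝔽.+-identityʳ 1F ⟩
    1F                ∎) }

  vertical : ∀ x y → (1F *F x) +F (0F *F y) ≡ x
  vertical x y = trans (cong₂ _+F_ (𝔽.*-identityˡ x) (𝔽.zeroˡ y)) (𝔽.+-identityʳ x)

  base-on-line : ∀ s l → OnLine F (line s l) s
  base-on-line (x , y) zero    = vertical x y
  base-on-line s       (suc m) = refl

  on-line : ∀ s u l → InDirection s u l → OnLine F (line s l) u
  on-line s (x , y) zero    p       = trans (vertical x y) p
  on-line s u       (suc m) (_ , p) = p

  open Containers (≡-dec Fin._≟_ Fin._≟_) mem cls cls-exchange public

  -- Equal directions would put both `b` and `c` on the line through `a` in direction `cls a b`.
  IsArc⇒Arc : ∀ {P} → IsArc F P → Arc P
  IsArc⇒Arc arc {a} {b} {c} a∈ b∈ c∈ a≢b a≢c b≢c e = arc a b c a∈ b∈ c∈ a≢b a≢c b≢c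
    (line a (cls a b) , base-on-line a (cls a b) , on-line a b (cls a b) (cls-correct a b)
    , on-line a c (cls a b) (subst (InDirection a c) (sym e) (cls-correct a c)))

  initial : ∀ {k L} → Unique L → All (IsArcOfSize F k) L → Config [] (points q) k L
  initial uL arcs = record
    { S-unique = []
    ; C-unique = points-unique q
    ; disjoint = λ _ ()
    ; family   = record
      { unique    = uL
      ; separated = λ _ _ agree → lookup-injective (λ x → lookup-injective (λ y → agree (∈-points (x , y))))
      ; sized     = λ {P} P∈ → trans (size≡∑ P) (proj₂ (All.lookup arcs P∈))
      }
    ; arcs     = λ {P} P∈ → IsArc⇒Arc {P} (proj₁ (All.lookup arcs P∈))
    ; contains = λ _ ()
    }

-- Choice of parameters

^-distribʳ-* : ∀ a b n → (a * b) ^ n ≡ a ^ n * b ^ n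
^-distribʳ-* a b zero    = refl
^-distribʳ-* a b (suc n) = trans (cong (a * b *_) (^-distribʳ-* a b n)) (regroup a b (a ^ n) (b ^ n))
  where
  regroup : ∀ a b c d → a * b * (c * d) ≡ a * c * (b * d)
  regroup = solve-∀

^-cancelˡ-≤ : ∀ {a b} n → .{{_ : NonZero n}} → a ^ n ≤ b ^ n → a ≤ b
^-cancelˡ-≤ n aⁿ≤bⁿ = ≮⇒≥ λ b<a → <⇒≱ (^-monoˡ-< n b<a) aⁿ≤bⁿ

1+n≤2^n : ∀ n → suc n ≤ 2 ^ n
1+n≤2^n zero    = ≤-refl
1+n≤2^n (suc n) = begin
  1 + suc n            ≤⟨ +-mono-≤ (m^n>0 2 n) (1+n≤2^n n) ⟩
  2 ^ n + 2 ^ n        ≡⟨ cong (2 ^ n +_) (+-identityʳ (2 ^ n)) ⟨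
  2 ^ suc n            ∎
  where open ≤-Reasoning

-- Bernoulli's inequality `(1 + 1/b)^t ≥ 1 + t/b`, multiplied by `b^(t+1)`. The case `t = b` gives
-- `(1 + 1/b)^b ≥ 2`.
bernoulli : ∀ b t → b ^ t * (b + t) ≤ b * suc b ^ t
bernoulli b zero    = ≤-reflexive (base b)
  where
  base : ∀ b → 1 * (b + 0) ≡ b * 1
  base = solve-∀
bernoulli b (suc t) = begin
  b * b ^ t * (b + suc t)             ≤⟨ m≤m+n _ (b ^ t * t) ⟩
  b * b ^ t * (b + suc t) + b ^ t * t ≡⟨ expand b (b ^ t) t ⟩
  suc b * (b ^ t * (b + t))           ≤⟨ *-monoʳ-≤ (suc b) (bernoulli b t) ⟩
  suc b * (b * suc b ^ t)             ≡⟨ swap (suc b) b (suc b ^ t) ⟩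
  b * (suc b * suc b ^ t)             ∎
  where
  open ≤-Reasoning
  expand : ∀ b z t → b * z * (b + suc t) + z * t ≡ suc b * (z * (b + t))
  expand = solve-∀
  swap : ∀ a b c → a * (b * c) ≡ b * (a * c)
  swap = solve-∀

doubling : ∀ b .{{_ : NonZero b}} → 2 * b ^ b ≤ suc b ^ b
doubling b = *-cancelˡ-≤ b (begin
  b * (2 * b ^ b)      ≡⟨ regroup b (b ^ b) ⟩
  b ^ b * (b + b)      ≤⟨ bernoulli b b ⟩
  b * suc b ^ b        ∎)
  where
  open ≤-Reasoning
  regroup : ∀ b z → b * (2 * z) ≡ z * (b + b)
  regroup = solve-∀

doubling-^ : ∀ b .{{_ : NonZero b}} y → 2 ^ y * b ^ (b * y) ≤ suc b ^ (b * y)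
doubling-^ b y = begin
  2 ^ y * b ^ (b * y)      ≡⟨ cong (2 ^ y *_) (^-*-assoc b b y) ⟨
  2 ^ y * (b ^ b) ^ y      ≡⟨ ^-distribʳ-* 2 (b ^ b) y ⟨
  (2 * b ^ b) ^ y          ≤⟨ ^-monoˡ-≤ y (doubling b) ⟩
  (suc b ^ b) ^ y          ≡⟨ ^-*-assoc (suc b) b y ⟩
  suc b ^ (b * y)          ∎
  where open ≤-Reasoning

doubling-≤ : ∀ b .{{_ : NonZero b}} y k → b * y ≤ k → 2 ^ y * b ^ k ≤ suc b ^ k
doubling-≤ b y k by≤k = begin
  2 ^ y * b ^ k                          ≡⟨ cong (λ z → 2 ^ y * b ^ z) k≡ ⟨
  2 ^ y * b ^ (b * y + d)                ≡⟨ cong (2 ^ y *_) (^-distribˡ-+-* b (b * y) d) ⟩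
  2 ^ y * (b ^ (b * y) * b ^ d)          ≡⟨ *-assoc (2 ^ y) _ _ ⟨
  2 ^ y * b ^ (b * y) * b ^ d            ≤⟨ *-mono-≤ (doubling-^ b y) (^-monoˡ-≤ d (n≤1+n b)) ⟩
  suc b ^ (b * y) * suc b ^ d            ≡⟨ ^-distribˡ-+-* (suc b) (b * y) d ⟨
  suc b ^ (b * y + d)                    ≡⟨ cong (suc b ^_) k≡ ⟩
  suc b ^ k                              ∎
  where
  open ≤-Reasoning
  d = k ∸ b * y
  k≡ : b * y + d ≡ k
  k≡ = m+[n∸m]≡n by≤k

-- Factor by factor: `(m + 1) M ≤ m N` survives the subtraction of `(m + 1) i` on the left and `m i`
-- on the right. In this way a factor `(1 + 1/m)^k` is absorbed by enlarging `M`.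
P′-scale : ∀ m {M N} k → suc m * M ≤ m * N → suc m ^ k * (M P′ k) ≤ m ^ k * (N P′ k)
P′-scale m         zero    _  = ≤-refl
P′-scale m {M} {N} (suc k) le = begin
  suc m * suc m ^ k * ((M ∸ k) * (M P′ k))    ≡⟨ regroup (suc m) (suc m ^ k) (M ∸ k) (M P′ k) ⟩
  suc m * (M ∸ k) * (suc m ^ k * (M P′ k))    ≤⟨ *-mono-≤ factor (P′-scale m k le) ⟩
  m * (N ∸ k) * (m ^ k * (N P′ k))            ≡⟨ regroup m (m ^ k) (N ∸ k) (N P′ k) ⟨
  m * m ^ k * ((N ∸ k) * (N P′ k))            ∎
  where
  open ≤-Reasoning
  regroup : ∀ a b c d → a * b * (c * d) ≡ a * c * (b * d)
  regroup = solve-∀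
  factor : suc m * (M ∸ k) ≤ m * (N ∸ k)
  factor = begin
    suc m * (M ∸ k)          ≡⟨ *-distribˡ-∸ (suc m) M k ⟩
    suc m * M ∸ suc m * k    ≤⟨ ∸-mono le (*-monoˡ-≤ k (n≤1+n m)) ⟩
    m * N ∸ m * k            ≡⟨ *-distribˡ-∸ m N k ⟨
    m * (N ∸ k)              ∎

m<[1+m/n]*n : ∀ m n .{{_ : NonZero n}} → m < suc (m / n) * n
m<[1+m/n]*n m n = begin-strict
  m                     ≡⟨ m≡m%n+[m/n]*n m n ⟩
  m % n + m / n * n     <⟨ +-monoˡ-< (m / n * n) (m%n<n m n) ⟩
  n + m / n * n         ∎
  where open ≤-Reasoning

-- Here `suc m` is the integer part of the `e`-th root of `suc q`. It is found by induction on `q`,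
-- since it grows by at most one when `q` does.
root : ∀ e .{{_ : NonZero e}} q → ∃ λ m → suc m ^ e ≤ suc q × suc q < suc (suc m) ^ e
root e zero = 0 , ≤-reflexive (^-zeroˡ e) , ≤-trans (≤-reflexive (cong suc (sym (^-zeroˡ e)))) (^-monoˡ-< e (s≤s (s≤s z≤n)))
root e (suc q) with m , lower , upper ← root e q with suc (suc m) ^ e ≤? suc (suc q)
... | yes le = suc m , le , ≤-<-trans upper (^-monoˡ-< e ≤-refl)
... | no  ≰  = m , m≤n⇒m≤1+n lower , ≰⇒> ≰

-- The numerical hypotheses of `Bound` and `seeds` for `r = q + 1` and `n = q²`, together with
-- `cheap`: the total branching cost is at most `(1 + 1/m)^k`.
record Parameters (q k m : ℕ) : Set where
  field
    s β T Q : ℕ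
    s≤k     : s ≤ k
    s-large : 2 * (suc m * suc q) ≤ s * suc β
    Q-large : 1 + q * q * k ≤ Q
    T-large : q * q * β ^ T ≤ q * suc β ^ T
    cheap   : Q ^ (s + T) * m ^ k ≤ suc m ^ k

parameters : ∀ e q k m → e ≡ 27 → 1 ≤ m → 3 * e + 3 * (e * e) ≤ m → 1 ≤ q → m ^ e ≤ q → q < suc m ^ e →
  k ≤ q → q ^ 2 < k ^ 3 → Parameters q k m
parameters e q k m e≡27 1≤m em≤m 1≤q mᵉ≤q q<mᵉ k≤q q²<k³ = record
  { s = s ; β = β ; T = T ; Q = Q
  ; s≤k     = ≤-trans (m≤m*n s (m ^ 3)) s*m³≤k
  ; s-large = s-large
  ; Q-large = Q-large
  ; T-large = T-large
  ; cheap   = cheap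
  }
  where
  open ≤-Reasoning
  instance
    m≢0 : NonZero m
    m≢0 = >-nonZero 1≤m
    m³≢0 : NonZero (m ^ 3)
    m³≢0 = m^n≢0 m 3
    m⁴≢0 : NonZero (m ^ 4)
    m⁴≢0 = m^n≢0 m 4
    m⁷≢0 : NonZero (m ^ 7)
    m⁷≢0 = m^n≢0 m 7
    q≢0 : NonZero q
    q≢0 = >-nonZero 1≤q

  -- The product `s β` is of order `k² / m⁷ ≥ m² q`, ample for `s-large`. Since `(1 + 1/β)^β ≥ 2`
  -- and `q < 2^(m e)`, the exponent `T = β m e` brings `q²` down to `q`; and `Q` is at least
  -- `(q + 1)³`.
  s = k / m ^ 3
  β = k / m ^ 4
  T = β * (m * e)
  Q = 2 ^ (m * e * 3)

  s*m³≤k : s * m ^ 3 ≤ k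
  s*m³≤k = m/n*n≤m k (m ^ 3)
  β*m⁴≤k : β * m ^ 4 ≤ k
  β*m⁴≤k = m/n*n≤m k (m ^ 4)

  q<2^ : suc q ≤ 2 ^ (m * e)
  q<2^ = begin
    suc q          ≤⟨ q<mᵉ ⟩
    suc m ^ e      ≤⟨ ^-monoˡ-≤ e (1+n≤2^n m) ⟩
    (2 ^ m) ^ e    ≡⟨ ^-*-assoc 2 m e ⟩
    2 ^ (m * e)    ∎

  -- In cubes: `m²⁷ q³ ≤ q⁴ ≤ k⁶`.
  k²-large : m ^ 9 * q ≤ k ^ 2
  k²-large = ^-cancelˡ-≤ 3 (begin
    (m ^ 9 * q) ^ 3        ≡⟨ ^-distribʳ-* (m ^ 9) q 3 ⟩
    (m ^ 9) ^ 3 * q ^ 3    ≡⟨ cong (_* q ^ 3) (trans (^-*-assoc m 9 3) (cong (m ^_) (sym e≡27))) ⟩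
    m ^ e * q ^ 3          ≤⟨ *-monoˡ-≤ (q ^ 3) mᵉ≤q ⟩
    q ^ 4                  ≡⟨ ^-*-assoc q 2 2 ⟨
    (q ^ 2) ^ 2            ≤⟨ ^-monoˡ-≤ 2 (<⇒≤ q²<k³) ⟩
    (k ^ 3) ^ 2            ≡⟨ trans (^-*-assoc k 3 2) (sym (^-*-assoc k 2 3)) ⟩
    (k ^ 2) ^ 3            ∎)

  m⁴≤k : m ^ 4 ≤ k
  m⁴≤k = ^-cancelˡ-≤ 2 (begin
    (m ^ 4) ^ 2    ≡⟨ ^-*-assoc m 4 2 ⟩
    m ^ 8          ≤⟨ ^-monoʳ-≤ m {8} {9} (n≤1+n 8) ⟩
    m ^ 9          ≤⟨ m≤m*n (m ^ 9) q ⟩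
    m ^ 9 * q      ≤⟨ k²-large ⟩
    k ^ 2          ∎)

  positive : ∀ d .{{_ : NonZero d}} → d ≤ k → 1 ≤ k / d
  positive d d≤k = ≮⇒≥ λ k/d<1 → <⇒≱ (m<[1+m/n]*n k d)
    (≤-trans (*-monoˡ-≤ d k/d<1) (≤-trans (≤-reflexive (*-identityˡ d)) d≤k))

  1≤s : 1 ≤ s
  1≤s = positive (m ^ 3) (≤-trans (^-monoʳ-≤ m {3} {4} (n≤1+n 3)) m⁴≤k)

  instance
    β≢0 : NonZero β
    β≢0 = >-nonZero (positive (m ^ 4) m⁴≤k)

  16≤m : 16 ≤ m
  16≤m = ≤-trans (≤-trans (m≤m+n 16 65) (≤-reflexive (cong (3 *_) (sym e≡27)))) (≤-trans (m≤m+n (3 * e) _) em≤m)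

  s-large : 2 * (suc m * suc q) ≤ s * suc β
  -- The factor 2 makes up for rounding down `s`: as `s ≥ 1`, `k < (s + 1) m³ ≤ 2 s m³`.
  s-large = *-cancelˡ-≤ 2 (begin
    2 * (2 * (suc m * suc q))              ≤⟨ *-monoʳ-≤ 2 (*-monoʳ-≤ 2 (*-mono-≤ (+-monoˡ-≤ m 1≤m) (+-monoˡ-≤ q 1≤q))) ⟩
    2 * (2 * ((m + m) * (q + q)))          ≡⟨ sixteen m q ⟩
    16 * (m * q)                           ≤⟨ *-monoˡ-≤ (m * q) 16≤m ⟩
    m * (m * q)                            ≤⟨ *-cancelˡ-≤ (m ^ 7) product ⟩
    2 * (s * suc β)                        ∎)
    where
    sixteen : ∀ m q → 2 * (2 * ((m + m) * (q + q))) ≡ 16 * (m * q)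
    sixteen = solve-∀
    nine : ∀ m q → m ^ 7 * (m * (m * q)) ≡ m ^ 9 * q
    nine m q = regroup m (m ^ 7) q
      where
      regroup : ∀ m z q → z * (m * (m * q)) ≡ m * (m * z) * q
      regroup = solve-∀
    double : suc s ≤ 2 * s
    double = ≤-trans (+-monoˡ-≤ s 1≤s) (≤-reflexive (cong (s +_) (sym (+-identityʳ s))))
    collect : ∀ s b x y → 2 * s * x * (b * y) ≡ x * y * (2 * (s * b))
    collect = solve-∀
    product : m ^ 7 * (m * (m * q)) ≤ m ^ 7 * (2 * (s * suc β))
    product = begin
      m ^ 7 * (m * (m * q))                      ≡⟨ nine m q ⟩
      m ^ 9 * q                                  ≤⟨ k²-large ⟩
      k * (k * 1)                                ≡⟨ cong (k *_) (*-identityʳ k) ⟩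
      k * k                                      ≤⟨ *-mono-≤ (<⇒≤ (m<[1+m/n]*n k (m ^ 3))) (<⇒≤ (m<[1+m/n]*n k (m ^ 4))) ⟩
      suc s * m ^ 3 * (suc β * m ^ 4)            ≤⟨ *-monoˡ-≤ (suc β * m ^ 4) (*-monoˡ-≤ (m ^ 3) double) ⟩
      2 * s * m ^ 3 * (suc β * m ^ 4)            ≡⟨ collect s (suc β) (m ^ 3) (m ^ 4) ⟩
      m ^ 3 * m ^ 4 * (2 * (s * suc β))          ≡⟨ cong (_* (2 * (s * suc β))) (^-distribˡ-+-* m 3 4) ⟨
      m ^ 7 * (2 * (s * suc β))                  ∎

  Q-large : 1 + q * q * k ≤ Q
  Q-large = begin
    1 + q * q * k              ≤⟨ +-monoʳ-≤ 1 (*-monoʳ-≤ (q * q) k≤q) ⟩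
    1 + q * q * q              ≤⟨ m≤m+n _ (3 * q * q + 3 * q) ⟩
    1 + q * q * q + (3 * q * q + 3 * q) ≡⟨ cube q ⟩
    suc q ^ 3                  ≤⟨ ^-monoˡ-≤ 3 q<2^ ⟩
    (2 ^ (m * e)) ^ 3          ≡⟨ ^-*-assoc 2 (m * e) 3 ⟩
    Q                          ∎
    where
    cube : ∀ q → 1 + q * q * q + (3 * q * q + 3 * q) ≡ suc q * (suc q * (suc q * 1))
    cube = solve-∀

  T-large : q * q * β ^ T ≤ q * suc β ^ T
  T-large = begin
    q * q * β ^ T              ≡⟨ *-assoc q q _ ⟩
    q * (q * β ^ T)            ≤⟨ *-monoʳ-≤ q (*-monoˡ-≤ (β ^ T) (<⇒≤ q<2^)) ⟩
    q * (2 ^ (m * e) * β ^ T)  ≤⟨ *-monoʳ-≤ q (doubling-^ β (m * e)) ⟩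
    q * suc β ^ T              ∎

  cheap : Q ^ (s + T) * m ^ k ≤ suc m ^ k
  cheap = begin
    Q ^ (s + T) * m ^ k                ≡⟨ cong (_* m ^ k) (^-*-assoc 2 (m * e * 3) (s + T)) ⟩
    2 ^ (m * e * 3 * (s + T)) * m ^ k  ≤⟨ doubling-≤ m (m * e * 3 * (s + T)) k (*-cancelˡ-≤ m exponent) ⟩
    suc m ^ k                          ∎
    where
    split : ∀ m e s b → m * (m * (m * e * 3 * (s + b * (m * e)))) ≡
              3 * e * (s * (m * (m * (m * 1)))) + 3 * (e * e) * (b * (m * (m * (m * (m * 1)))))
    split = solve-∀
    -- `doubling-≤` asks for `m` times the exponent of 2 to be at most `k`. One more factor `m`
    -- makes `s m³` and `β m⁴` appear, both at most `k`, with total coefficient `3 e + 3 e² ≤ m`.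
    exponent : m * (m * (m * e * 3 * (s + T))) ≤ m * k
    exponent = begin
      m * (m * (m * e * 3 * (s + T)))                        ≡⟨ split m e s β ⟩
      3 * e * (s * m ^ 3) + 3 * (e * e) * (β * m ^ 4)        ≤⟨ +-mono-≤ (*-monoʳ-≤ (3 * e) s*m³≤k) (*-monoʳ-≤ (3 * (e * e)) β*m⁴≤k) ⟩
      3 * e * k + 3 * (e * e) * k                            ≡⟨ *-distribʳ-+ k (3 * e) _ ⟨
      (3 * e + 3 * (e * e)) * k                              ≤⟨ *-monoˡ-≤ k em≤m ⟩
      m * k                                                  ∎

-- Rational numbers

toℚᵘ-/ : ∀ a d → toℚᵘ ((ℤ.+ a) ℚ./ suc d) ℚᵘ.≃ mkℚᵘ (ℤ.+ a) d
toℚᵘ-/ a d = ℚ.toℚᵘ-fromℚᵘ (mkℚᵘ (ℤ.+ a) d)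

toℚ-+ : ∀ a b → toℚ (a + b) ≡ toℚ a ℚ.+ toℚ b
toℚ-+ a b = ℚ.toℚᵘ-injective (begin-equality
  toℚᵘ (toℚ (a + b))                ≃⟨ toℚᵘ-/ (a + b) 0 ⟩
  mkℚᵘ (ℤ.+ (a + b)) 0                ≃⟨ *≡* (cong (ℤ._* ℤ.+ 1) (cong₂ ℤ._+_ (sym (ℤ.*-identityʳ (ℤ.+ a))) (sym (ℤ.*-identityʳ (ℤ.+ b))))) ⟩
  mkℚᵘ (ℤ.+ a) 0 ℚᵘ.+ mkℚᵘ (ℤ.+ b) 0    ≃⟨ ℚᵘ.+-cong (toℚᵘ-/ a 0) (toℚᵘ-/ b 0) ⟨
  toℚᵘ (toℚ a) ℚᵘ.+ toℚᵘ (toℚ b)    ≃⟨ ℚ.toℚᵘ-homo-+ (toℚ a) (toℚ b) ⟨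
  toℚᵘ (toℚ a ℚ.+ toℚ b)            ∎)
  where open ℚᵘ.≤-Reasoning

toℚ-* : ∀ a b → toℚ (a * b) ≡ toℚ a ℚ.* toℚ b
toℚ-* a b = ℚ.toℚᵘ-injective (begin-equality
  toℚᵘ (toℚ (a * b))                ≃⟨ toℚᵘ-/ (a * b) 0 ⟩
  mkℚᵘ (ℤ.+ (a * b)) 0                ≃⟨ *≡* (cong (ℤ._* ℤ.+ 1) (ℤ.pos-* a b)) ⟩
  mkℚᵘ (ℤ.+ a) 0 ℚᵘ.* mkℚᵘ (ℤ.+ b) 0    ≃⟨ ℚᵘ.*-cong (toℚᵘ-/ a 0) (toℚᵘ-/ b 0) ⟨
  toℚᵘ (toℚ a) ℚᵘ.* toℚᵘ (toℚ b)    ≃⟨ ℚ.toℚᵘ-homo-* (toℚ a) (toℚ b) ⟨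
  toℚᵘ (toℚ a ℚ.* toℚ b)            ∎)
  where open ℚᵘ.≤-Reasoning

/-*-cancel : ∀ a d .{{_ : NonZero d}} → ((ℤ.+ a) ℚ./ d) ℚ.* toℚ d ≡ toℚ a
/-*-cancel a (suc d) = ℚ.toℚᵘ-injective (begin-equality
  toℚᵘ (((ℤ.+ a) ℚ./ suc d) ℚ.* toℚ (suc d))              ≃⟨ ℚ.toℚᵘ-homo-* ((ℤ.+ a) ℚ./ suc d) (toℚ (suc d)) ⟩
  toℚᵘ ((ℤ.+ a) ℚ./ suc d) ℚᵘ.* toℚᵘ (toℚ (suc d))        ≃⟨ ℚᵘ.*-cong (toℚᵘ-/ a d) (toℚᵘ-/ (suc d) 0) ⟩
  mkℚᵘ (ℤ.+ a) d ℚᵘ.* mkℚᵘ (ℤ.+ suc d) 0                    ≃⟨ *≡* (trans (ℤ.*-identityʳ (ℤ.+ a ℤ.* ℤ.+ suc d)) (cong (λ n → ℤ.+ a ℤ.* ℤ.+ n) (sym (*-identityʳ (suc d))))) ⟩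
  mkℚᵘ (ℤ.+ a) 0                                          ≃⟨ toℚᵘ-/ a 0 ⟨
  toℚᵘ (toℚ a)                                          ∎)
  where open ℚᵘ.≤-Reasoning

toℚ-mono-≤ : ∀ {a b} → a ≤ b → toℚ a ℚ.≤ toℚ b
toℚ-mono-≤ {a} {b} a≤b = ℚ.toℚᵘ-cancel-≤ (begin
  toℚᵘ (toℚ a)      ≃⟨ toℚᵘ-/ a 0 ⟩
  mkℚᵘ (ℤ.+ a) 0      ≤⟨ *≤* (ℤ.*-monoʳ-≤-nonNeg (ℤ.+ 1) (ℤ.+≤+ a≤b)) ⟩
  mkℚᵘ (ℤ.+ b) 0      ≃⟨ toℚᵘ-/ b 0 ⟨
  toℚᵘ (toℚ b)      ∎)
  where open ℚᵘ.≤-Reasoning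

toℚ-∸ : ∀ {a b} → b ≤ a → toℚ (a ∸ b) ≡ toℚ a ℚ.- toℚ b
toℚ-∸ {a} {b} b≤a = begin
  toℚ (a ∸ b)                                ≡⟨ ℚ.+-identityʳ _ ⟨
  toℚ (a ∸ b) ℚ.+ 0ℚ                         ≡⟨ cong (toℚ (a ∸ b) ℚ.+_) (ℚ.+-inverseʳ (toℚ b)) ⟨
  toℚ (a ∸ b) ℚ.+ (toℚ b ℚ.- toℚ b)          ≡⟨ ℚ.+-assoc (toℚ (a ∸ b)) (toℚ b) _ ⟨
  toℚ (a ∸ b) ℚ.+ toℚ b ℚ.- toℚ b            ≡⟨ cong (ℚ._- toℚ b) (trans (sym (toℚ-+ (a ∸ b) b)) (cong toℚ (m∸n+n≡m b≤a))) ⟩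
  toℚ a ℚ.- toℚ b                            ∎
  where open ≡-Reasoning

-- For `k ≤ n` the truncated subtractions in `P′` agree with the rational ones.
fallingℚ≡P′ : ∀ n k → k ≤ n → fallingℚ (toℚ n) k ≡ toℚ (n P′ k)
fallingℚ≡P′ n zero    _   = refl
fallingℚ≡P′ n (suc k) k<n = begin
  fallingℚ (toℚ n) k ℚ.* (toℚ n ℚ.- toℚ k)   ≡⟨ cong₂ ℚ._*_ (fallingℚ≡P′ n k (<⇒≤ k<n)) (sym (toℚ-∸ (<⇒≤ k<n))) ⟩
  toℚ (n P′ k) ℚ.* toℚ (n ∸ k)               ≡⟨ toℚ-* (n P′ k) (n ∸ k) ⟨
  toℚ ((n P′ k) * (n ∸ k))                   ≡⟨ cong toℚ (*-comm (n P′ k) (n ∸ k)) ⟩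
  toℚ ((n ∸ k) * (n P′ k))                   ∎
  where open ≡-Reasoning

≤-binomℚ : ∀ ℓ n k → k ≤ n → ℓ * k ! ≤ n P′ k → toℚ ℓ ℚ.≤ binomℚ (toℚ n) k
≤-binomℚ ℓ n k k≤n le = begin
  toℚ ℓ                              ≡⟨ ℚ.*-identityʳ (toℚ ℓ) ⟨
  toℚ ℓ ℚ.* 1ℚ                       ≡⟨ cong (toℚ ℓ ℚ.*_) (trans (ℚ.*-comm (toℚ (k !)) 1/k!) (/-*-cancel 1 (k !))) ⟨
  toℚ ℓ ℚ.* (toℚ (k !) ℚ.* 1/k!)     ≡⟨ ℚ.*-assoc (toℚ ℓ) (toℚ (k !)) 1/k! ⟨
  toℚ ℓ ℚ.* toℚ (k !) ℚ.* 1/k!       ≡⟨ cong (ℚ._* 1/k!) (toℚ-* ℓ (k !)) ⟨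
  toℚ (ℓ * k !) ℚ.* 1/k!             ≤⟨ ℚ.*-monoʳ-≤-nonNeg 1/k! (toℚ-mono-≤ le) ⟩
  toℚ (n P′ k) ℚ.* 1/k!              ≡⟨ cong (ℚ._* 1/k!) (fallingℚ≡P′ n k k≤n) ⟨
  binomℚ (toℚ n) k                   ∎
  where
  open ℚ.≤-Reasoning
  instance
    k!≢0 : NonZero (k !)
    k!≢0 = k !≢0
  1/k! : ℚ
  1/k! = (ℤ.+ 1) ℚ./ (k !)
  instance
    1/k!-nonNeg : ℚ.NonNegative 1/k!
    1/k!-nonNeg = ℚ.normalize-nonNeg 1 (k !)

-- The degree 27 makes m⁹q ≤ k² follow from mᵉ ≤ q and q² < k³. It is abstract because
-- normalising an open term x ^ 27 is infeasible.
abstract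
  rootDegree : ℕ
  rootDegree = 27

  rootDegree≡27 : rootDegree ≡ 27
  rootDegree≡27 = refl

1≤rootDegree : 1 ≤ rootDegree
1≤rootDegree = ≤-trans (s≤s z≤n) (≤-reflexive (sym rootDegree≡27))

instance
  rootDegree≢0 : NonZero rootDegree
  rootDegree≢0 = >-nonZero 1≤rootDegree

-- The error term `ε`

scale : ℕ → ℕ
scale q = suc (proj₁ (root rootDegree q))

-- (1 + ε q) q is the natural number q + excess, so all estimates stay in ℕ; excess takes
-- the predecessor of q as its argument.
excess : ℕ → ℕ
excess q = 5 + 4 * (suc q / scale q)

ε : ℕ → ℚ
ε zero    = 0ℚ
ε (suc q) = (ℤ.+ excess q) ℚ./ suc q

scale-lower : ∀ q → scale q ^ rootDegree ≤ suc q
scale-lower q = proj₁ (proj₂ (root rootDegree q))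

scale-upper : ∀ q → suc q < suc (scale q) ^ rootDegree
scale-upper q = proj₂ (proj₂ (root rootDegree q))

scale-large : ∀ t q → t ^ rootDegree ≤ suc q → t ≤ scale q
scale-large t q tᵉ≤q = s≤s⁻¹ (≰⇒> λ m<t → <⇒≱ (scale-upper q) (≤-trans (^-monoˡ-≤ rootDegree m<t) tᵉ≤q))

scale≤ : ∀ q → scale q ≤ suc q
scale≤ q = ≤-trans (≤-trans (≤-reflexive (sym (^-identityʳ (scale q)))) (^-monoʳ-≤ (scale q) {1} {rootDegree} 1≤rootDegree)) (scale-lower q)

-- Hence `ε` is at most 9 over `scale`: the 5 comes from `scale q ≤ suc q`, the 4 from `scale q`
-- times the rounded quotient being at most `suc q`.
excess-small : ∀ q → scale q * excess q ≤ 9 * suc q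
excess-small q = begin
  m * (5 + 4 * h)            ≡⟨ expand m h ⟩
  5 * m + 4 * (h * m)        ≤⟨ +-mono-≤ (*-monoʳ-≤ 5 (scale≤ q)) (*-monoʳ-≤ 4 (m/n*n≤m (suc q) m)) ⟩
  5 * suc q + 4 * suc q      ≡⟨ *-distribʳ-+ (suc q) 5 4 ⟨
  9 * suc q                  ∎
  where
  open ≤-Reasoning
  m = scale q
  h = suc q / m
  expand : ∀ m h → m * (5 + 4 * h) ≡ 5 * m + 4 * (h * m)
  expand = solve-∀

ε-nonNeg : ∀ q → 0ℚ ℚ.≤ ε q
ε-nonNeg zero    = ℚ.≤-refl
ε-nonNeg (suc q) = ℚ.nonNegative⁻¹ (ε (suc q)) {{ℚ.normalize-nonNeg (excess q) (suc q)}}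

ε-small : ∀ q d p → 9 * suc d < scale q → excess q * suc d < suc p * suc q
ε-small q d p m-large = *-cancelˡ-< m _ _ (begin-strict
  m * (excess q * suc d)       ≡⟨ *-assoc m (excess q) (suc d) ⟨
  m * excess q * suc d         ≤⟨ *-monoˡ-≤ (suc d) (excess-small q) ⟩
  9 * suc q * suc d            ≡⟨ swap (suc q) (suc d) ⟩
  9 * suc d * suc q            <⟨ *-monoˡ-< (suc q) m-large ⟩
  m * suc q                    ≤⟨ *-monoʳ-≤ m (m≤m+n (suc q) (p * suc q)) ⟩
  m * (suc p * suc q)          ∎)
  where
  open ≤-Reasoning
  m = scale q
  swap : ∀ a b → 9 * a * b ≡ 9 * b * a
  swap = solve-∀

ε→0 : ∀ η → 0ℚ ℚ.< η → ∃ λ N → ∀ q → N ≤ q → IsPrimePower q → ε q ℚ.< η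
ε→0 η@(mkℚ (ℤ.+ zero) d _) (ℚ.*<* (ℤ.+<+ ()))
-- This threshold forces the scale `m` above `9 * suc d`, so that `ε ≤ 9 / m < 1 / suc d ≤ η`.
ε→0 η@(mkℚ (ℤ.+ suc p) d _) _ = suc (9 * suc d) ^ rootDegree , small
  where
  small : ∀ q → suc (9 * suc d) ^ rootDegree ≤ q → IsPrimePower q → ε q ℚ.< η
  small zero    N≤0 _ = contradiction N≤0 (<⇒≱ (m^n>0 (suc (9 * suc d)) rootDegree))
  small (suc q) N≤q _ = ℚ.toℚᵘ-cancel-< (begin-strict
    toℚᵘ (ε (suc q))         ≃⟨ toℚᵘ-/ (excess q) q ⟩
    mkℚᵘ (ℤ.+ excess q) q      <⟨ *<* (subst₂ ℤ._<_ (ℤ.pos-* (excess q) (suc d)) (ℤ.pos-* (suc p) (suc q))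
                                  (ℤ.+<+ (ε-small q d p (scale-large (suc (9 * suc d)) q N≤q)))) ⟩
    mkℚᵘ (ℤ.+ suc p) d         ∎)
    where open ℚᵘ.≤-Reasoning
ε→0 η@(mkℚ (ℤ.-[1+ _ ]) d _) (ℚ.*<* ())

[1+ε]q≡ : ∀ q → (1ℚ ℚ.+ ε (suc q)) ℚ.* toℚ (suc q) ≡ toℚ (suc q + excess q)
[1+ε]q≡ q = begin
  (1ℚ ℚ.+ ε (suc q)) ℚ.* toℚ (suc q)                   ≡⟨ ℚ.*-distribʳ-+ (toℚ (suc q)) 1ℚ (ε (suc q)) ⟩
  1ℚ ℚ.* toℚ (suc q) ℚ.+ ε (suc q) ℚ.* toℚ (suc q)     ≡⟨ cong₂ ℚ._+_ (ℚ.*-identityˡ (toℚ (suc q))) (/-*-cancel (excess q) (suc q)) ⟩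
  toℚ (suc q) ℚ.+ toℚ (excess q)                       ≡⟨ toℚ-+ (suc q) (excess q) ⟨
  toℚ (suc q + excess q)                               ∎
  where open ≡-Reasoning

-- The bound on the number of arcs

arcs-bound : ∀ {q k m} (F : FiniteField q) → k ≤ q → Parameters q k m → .{{_ : NonZero m}} →
  (L : List (PointSet q)) → Unique L → All (IsArcOfSize F k) L →
  length L * k ! ≤ (q + (5 + 4 * (q / m))) P′ k
-- After multiplication by `m ^ k`, `cheap` trades the branching cost `Q ^ (s + T)` for
-- `(1 + 1/m)^k`, and `P′-scale` spends this on replacing `M` by `N`.
arcs-bound {q} {k} {m} F k≤q params L unique arcs = *-cancelˡ-≤ (m ^ k) {{m^n≢0 m k}} (begin
  m ^ k * (length L * k !)                       ≤⟨ *-monoʳ-≤ (m ^ k) (*-monoˡ-≤ (k !) count) ⟩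
  m ^ k * (Q ^ (s + T) * (M choose k) * k !)     ≡⟨ regroup (m ^ k) (Q ^ (s + T)) (M choose k) (k !) ⟩
  Q ^ (s + T) * m ^ k * ((M choose k) * k !)     ≡⟨ cong (Q ^ (s + T) * m ^ k *_) (choose*! M k) ⟩
  Q ^ (s + T) * m ^ k * (M P′ k)                 ≤⟨ *-monoˡ-≤ (M P′ k) cheap ⟩
  suc m ^ k * (M P′ k)                           ≤⟨ P′-scale m k M-scale ⟩
  m ^ k * (N P′ k)                               ∎)
  where
  open ≤-Reasoning
  open Parameters params
  open Plane F
  h = q / m
  -- As `q + 1 ≤ m (h + 1)`, the number `(1 + 1/m)(q + 1)` is at most `(q + 1) + (h + 1)`, which is
  -- `M`.
  M = q + (2 + h)
  -- This is `M + 3 (h + 1)`; the increment is at least `M / m` because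
  -- `M ≤ 3 (q + 1) ≤ 3 m (h + 1)`.
  N = q + (5 + 4 * h)
  regroup : ∀ a b c d → a * (b * c * d) ≡ b * a * (c * d)
  regroup = solve-∀
  q<mh : suc q ≤ m * suc h
  q<mh = ≤-trans (m<[1+m/n]*n q m) (≤-reflexive (*-comm (suc h) m))
  M-large : ∀ c → M < c → suc m * suc q ≤ m * c
  M-large c M<c = begin
    suc q + m * suc q            ≤⟨ +-monoˡ-≤ (m * suc q) q<mh ⟩
    m * suc h + m * suc q        ≡⟨ *-distribˡ-+ m (suc h) (suc q) ⟨
    m * (suc h + suc q)          ≤⟨ *-monoʳ-≤ m (≤-trans (≤-trans (≤-reflexive (rearrange h q)) (n≤1+n M)) M<c) ⟩
    m * c                        ∎
    where
    rearrange : ∀ h q → suc h + suc q ≡ q + (2 + h)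
    rearrange = solve-∀
  M-scale : suc m * M ≤ m * N
  M-scale = begin
    M + m * M                    ≤⟨ +-monoˡ-≤ (m * M) small ⟩
    3 * (m * suc h) + m * M      ≡⟨ collect m h q ⟩
    m * N                        ∎
    where
    double : ∀ q → q + (2 + q) + suc q ≡ 3 * suc q
    double = solve-∀
    collect : ∀ m h q → 3 * (m * suc h) + m * (q + (2 + h)) ≡ m * (q + (5 + 4 * h))
    collect = solve-∀
    small : M ≤ 3 * (m * suc h)
    small = begin
      q + (2 + h)            ≤⟨ +-monoʳ-≤ q (+-monoʳ-≤ 2 (m/n≤m q m)) ⟩
      q + (2 + q)            ≤⟨ m≤m+n _ (suc q) ⟩
      q + (2 + q) + suc q    ≡⟨ double q ⟩
      3 * suc q              ≤⟨ *-monoʳ-≤ 3 q<mh ⟩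
      3 * (m * suc h)        ∎
  open Bound (q * q) q k m M s β T Q (m≤m+n q _) (≤-trans k≤q (m≤m+n q _)) (s≤s z≤n) M-large s-large Q-large T-large
    using (seeds)
  count : length L ≤ Q ^ (s + T) * (M choose k)
  count = seeds s (initial unique arcs) (+-identityʳ s) (≤-reflexive (length-points q)) s≤k ≤-refl

-- For `k = q^t` and `δ = a / b` the hypothesis reads `t > 2/3 + 2δ`. If `k³ ≤ q²`, taking `b`-th
-- powers would contradict it.
q²<k³ : ∀ a b q k .{{_ : NonZero q}} → q ^ (2 * b + 6 * a) < k ^ (3 * b) → q ^ 2 < k ^ 3
q²<k³ a b q k lt = ≰⇒> λ k³≤q² → <⇒≱ lt (begin
  k ^ (3 * b)            ≡⟨ ^-*-assoc k 3 b ⟨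
  (k ^ 3) ^ b            ≤⟨ ^-monoˡ-≤ b k³≤q² ⟩
  (q ^ 2) ^ b            ≡⟨ ^-*-assoc q 2 b ⟩
  q ^ (2 * b)            ≤⟨ ^-monoʳ-≤ q (m≤m+n (2 * b) (6 * a)) ⟩
  q ^ (2 * b + 6 * a)    ∎)
  where open ≤-Reasoning

-- The lower bound on `m` under which the exponents in `cheap` fit; the final `q₀` is its power with
-- exponent `rootDegree`, so that `scale` reaches it.
threshold : ℕ
threshold = 3 * rootDegree + 3 * (rootDegree * rootDegree)

threshold≢0 : NonZero threshold
threshold≢0 = >-nonZero (≤-trans 1≤rootDegree (≤-trans (m≤n*m rootDegree 3) (m≤m+n (3 * rootDegree) _)))

theorem2 : (a b : ℕ) → 0 < a → 0 < b →
    Σ (ℕ → ℚ) λ ε →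
    (∀ q → 0ℚ ℚ.≤ ε q) ×
    (∀ η → 0ℚ ℚ.< η → ∃ λ N → ∀ q → N ≤ q → IsPrimePower q → ε q ℚ.< η) ×
    (∃ λ q₀ → ∀ q → q₀ ≤ q → IsPrimePower q → (F : FiniteField q) →
    ∀ k → q ^ (2 * b + 6 * a) < k ^ (3 * b) → k ≤ q →
    (L : List (PointSet q)) → Unique L → All (IsArcOfSize F k) L →
    toℚ (length L) ℚ.≤ binomℚ ((1ℚ ℚ.+ ε q) ℚ.* toℚ q) k)
theorem2 a b _ _ = ε , ε-nonNeg , ε→0 , threshold ^ rootDegree , bound
  where
  bound : ∀ q → threshold ^ rootDegree ≤ q → IsPrimePower q → (F : FiniteField q) →
    ∀ k → q ^ (2 * b + 6 * a) < k ^ (3 * b) → k ≤ q →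
    (L : List (PointSet q)) → Unique L → All (IsArcOfSize F k) L →
    toℚ (length L) ℚ.≤ binomℚ ((1ℚ ℚ.+ ε q) ℚ.* toℚ q) k
  bound zero    q₀≤0 = contradiction q₀≤0 (<⇒≱ (m^n>0 threshold {{threshold≢0}} rootDegree))
  bound (suc q) q₀≤q _ F k k-large k≤q L unique arcs =
    subst (λ x → toℚ (length L) ℚ.≤ binomℚ x k) (sym ([1+ε]q≡ q))
      (≤-binomℚ (length L) (suc q + excess q) k (≤-trans k≤q (m≤m+n (suc q) _))
        (arcs-bound F k≤q
          (parameters rootDegree (suc q) k (scale q) rootDegree≡27 (s≤s z≤n) (scale-large threshold q q₀≤q) (s≤s z≤n)
            (scale-lower q) (scale-upper q) k≤q (q²<k³ a b (suc q) k k-large))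
          L unique arcs))
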